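{- Let $k\ge 3$. Then $\displaystyle\lim_{n\to\infty}\frac{M_k(n)-L_k(n)}{L_k(n)}=0$, where $L_k(n)=|\mathbf{S}_k(n)|$.
   Context: Let $\Sigma=\{0,1,\dots,k-1\}$. Strings are compared lexicographically ($\alpha<\beta$ if $\alpha$ is a proper prefix of $\beta$, or $\alpha$ has the smaller symbol at the first index where they differ). For $\alpha=a_1\cdots a_n$, $\alpha^R=a_n\cdots a_1$; $[\alpha]$ is the set of rotations of $\alpha$. $\alpha$ is a necklace if it is the lexicographically smallest element of $[\alpha]$; a bracelet if it is the lexicographically smallest element of $[\alpha]\cup[\alpha^R]$. A necklace $\alpha$ is symmetric if $\alpha^R\in[\alpha]$, asymmetric otherwise. $\mathbf{A}_k(n)$ is the set of asymmetric bracelets of length $n$ over $\Sigma$, and $\mathbf{S}_k(n)=\bigcup_{\alpha\in\mathbf{A}_k(n)}[\alpha]$. A cyclic sequence $s_1\cdots s_L$ has windows $w_t=s_t\cdots s_{t+n-1}$ ($t=1,\dots,L$, indices mod $L$); it is an orientable sequence of order $n$ if the $2L$ strings $w_1,\dots,w_L,w_1^R,\dots,w_L^R$ are pairwise distinct. $M_k(n)$ is the maximum length of an orientable sequence of order $n$ over $\Sigma$. -}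

module Defs where

open import Data.Fin.Base using (Fin; toℕ)
import Data.Fin.Base as Fin
import Data.Fin.Properties as Fin
open import Data.Integer.Base using (ℤ)
open import Data.List.Base as List using (List; allFin; cartesianProductWith; filter; length)
open import Data.List.Membership.Propositional using (_∈_; lose)
open import Data.List.Membership.Propositional.Properties using (∈-allFin; ∈-cartesianProductWith⁺; ∈-filter⁺; ∈-filter⁻)
import Data.List.Relation.Unary.All as All
open import Data.List.Relation.Unary.Any as Any using (here)
open import Data.List.Relation.Unary.Any.Properties using (lookup-index)
open import Data.List.Relation.Unary.Unique.Propositional using (Unique; []; _∷_)
import Data.List.Relation.Unary.Unique.Propositional.Properties as Unique
open import Data.Nat.Base using (ℕ; zero; suc; _+_; _≤_; NonZero)
open import Data.Nat.DivMod using (_mod_; _%_; %-distribˡ-+; m%n%n≡m%n; m%n<n)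
open import Data.Nat.Properties using (≤∧≢⇒<; ≤-pred)
open import Data.Product.Base using (Σ-syntax; ∃; ∃-syntax; _×_; _,_; proj₁; proj₂)
open import Data.Rational.Base as ℚ using (ℚ; 0ℚ; _/_)
open import Data.Sum.Base using (_⊎_; inj₁; inj₂; [_,_])
open import Data.Sum.Properties using (inj₁-injective)
open import Data.Vec.Base using (Vec; []; _∷_; lookup; tabulate; reverse)
open import Data.Vec.Properties using (≡-dec; ∷-injective; tabulate-cong)
import Data.Vec.Relation.Binary.Lex.Strict as Lex
open import Function.Base using (_∘_)
open import Function.Bundles using (_⇔_; mk⇔)
open import Function.Definitions using (Injective)
open import Relation.Binary.Definitions using (DecidableEquality)
open import Relation.Binary.PropositionalEquality using (_≡_; refl; sym; trans; cong; module ≡-Reasoning)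
open import Relation.Nullary.Decidable using (Dec; yes; no; map′; _×-dec_; _→-dec_; _⊎-dec_; ¬?)
open import Relation.Nullary.Negation using (¬_)
open import Relation.Unary using (Decidable)

private
  variable
    k m n : ℕ

Str : ℕ → ℕ → Set
Str k n = Vec (Fin k) n

-- Only strings of equal length are ever compared, so the proper-prefix
-- clause of the lexicographic order does not occur.
infix 4 _≤ˡᵉˣ_
_≤ˡᵉˣ_ : Str k n → Str k n → Set
_≤ˡᵉˣ_ = Lex.Lex-≤ _≡_ Fin._<_

-- shift i d is the index (i + d) mod m.
shift : Fin m → ℕ → Fin m
shift {m = suc _} i d = (toℕ i + d) mod (suc _)

rotate : ℕ → Str k n → Str k n
rotate d α = tabulate (λ i → lookup α (shift i d))

infix 4 _∈[_]
_∈[_] : Str k n → Str k n → Set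
β ∈[ α ] = ∃[ d ] β ≡ rotate d α

Bracelet : Str k n → Set
Bracelet α = ∀ β → β ∈[ α ] ⊎ β ∈[ reverse α ] → α ≤ˡᵉˣ β

Symmetric : Str k n → Set
Symmetric α = reverse α ∈[ α ]

-- Every bracelet is a necklace, so Symmetric applies to it.
AsymmetricBracelet : Str k n → Set
AsymmetricBracelet α = Bracelet α × ¬ Symmetric α

InS : Str k n → Set
InS β = ∃[ α ] AsymmetricBracelet α × β ∈[ α ]

window : (n : ℕ) → Str k m → Fin m → Str k n
window n s t = tabulate (λ j → lookup s (shift t (toℕ j)))

-- A vector s of length m is read as a cyclic sequence; n may exceed m.
Orientable : (n : ℕ) → Str k m → Set
Orientable n s =
  Injective _≡_ _≡_ [ window n s , reverse ∘ window n s ]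

IsMaxLength : (k n m : ℕ) → Set
IsMaxLength k n m =
  (Σ[ s ∈ Str k m ] Orientable n s) ×
  (∀ {l} (s : Str k l) → Orientable n s → l ≤ m)

-- The quotient has to be defined for all sufficiently large n.
QuotientTendsTo : (ℕ → ℤ) → (ℕ → ℕ) → ℚ → Set
QuotientTendsTo a b x =
  ∀ (ε : ℚ) → 0ℚ ℚ.< ε → ∃[ N ] ∀ n → N ≤ n →
    Σ[ nz ∈ NonZero (b n) ] ℚ.∣ _/_ (a n) (b n) {{nz}} ℚ.- x ∣ ℚ.< ε

strings : ∀ k n → List (Str k n)
strings k zero    = [] List.∷ List.[]
strings k (suc n) = cartesianProductWith _∷_ (allFin k) (strings k n)

∈-strings : (α : Str k n) → α ∈ strings k n
∈-strings []      = here refl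
∈-strings (x ∷ α) = ∈-cartesianProductWith⁺ _∷_ (∈-allFin x) (∈-strings α)

strings-unique : ∀ k n → Unique (strings k n)
strings-unique k zero    = All.[] ∷ []
strings-unique k (suc n) =
  Unique.cartesianProductWith⁺ _∷_ ∷-injective (Unique.allFin⁺ k) (strings-unique k n)

_≟ˢ_ : DecidableEquality (Str k n)
_≟ˢ_ = ≡-dec Fin._≟_

∀-string? : {P : Str k n → Set} → Decidable P → Dec (∀ α → P α)
∀-string? P? = map′ (λ ps α → All.lookup ps (∈-strings α))
                    (λ p → All.universal p _)
                    (All.all? P? (strings _ _))

∃-string? : {P : Str k n → Set} → Decidable P → Dec (∃ P)
∃-string? P? = map′ Any.satisfied
                    (λ (α , p) → lose (∈-strings α) p)
                    (Any.any? P? (strings _ _))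

shift-mod : ∀ (i : Fin (suc m)) d → shift i (toℕ (d mod suc m)) ≡ shift i d
shift-mod {m} i d = Fin.fromℕ<-cong _ _ eq (m%n<n (toℕ i + toℕ (d mod suc m)) (suc m)) (m%n<n (toℕ i + d) (suc m))
  where
  open ≡-Reasoning
  eq : (toℕ i + toℕ (d mod suc m)) % suc m ≡ (toℕ i + d) % suc m
  eq = begin
    (toℕ i + toℕ (d mod suc m)) % suc m
      ≡⟨ cong (λ z → (toℕ i + z) % suc m) (Fin.toℕ-fromℕ< (m%n<n d (suc m))) ⟩
    (toℕ i + d % suc m) % suc m
      ≡⟨ %-distribˡ-+ (toℕ i) (d % suc m) (suc m) ⟩
    (toℕ i % suc m + d % suc m % suc m) % suc m
      ≡⟨ cong (λ z → (toℕ i % suc m + z) % suc m) (m%n%n≡m%n d (suc m)) ⟩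
    (toℕ i % suc m + d % suc m) % suc m
      ≡⟨ %-distribˡ-+ (toℕ i) d (suc m) ⟨
    (toℕ i + d) % suc m ∎

_∈[_]? : (β α : Str k n) → Dec (β ∈[ α ])
[] ∈[ [] ]? = yes (0 , refl)
β@(_ ∷ _) ∈[ α ]? =
  map′ (λ (i , eq) → toℕ i , eq)
       (λ (d , eq) → d mod suc _ ,
          trans eq (tabulate-cong (λ i → cong (lookup α) (sym (shift-mod i d)))))
       (Fin.any? (λ i → β ≟ˢ rotate (toℕ i) α))

bracelet? : Decidable (Bracelet {k} {n})
bracelet? α = ∀-string? λ β →
  ((β ∈[ α ]?) ⊎-dec (β ∈[ reverse α ]?)) →-dec Lex.≤-dec Fin._≟_ Fin._<?_ α β

asymmetricBracelet? : Decidable (AsymmetricBracelet {k} {n})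
asymmetricBracelet? α = bracelet? α ×-dec ¬? (reverse α ∈[ α ]?)

inS? : Decidable (InS {k} {n})
inS? β = ∃-string? λ α → asymmetricBracelet? α ×-dec (β ∈[ α ]?)

S : ∀ k n → List (Str k n)
S k n = filter inS? (strings k n)

∈-S : (α : Str k n) → (α ∈ S k n) ⇔ InS α
∈-S α = mk⇔ (λ p → proj₂ (∈-filter⁻ inS? {xs = strings _ _} p))
            (λ p → ∈-filter⁺ inS? (∈-strings α) p)

S-unique : ∀ k n → Unique (S k n)
S-unique k n = Unique.filter⁺ inS? (strings-unique k n)

L : ℕ → ℕ → ℕ
L k n = length (S k n)

∀⊎? : {P : Fin m ⊎ Fin m → Set} → Decidable P → Dec (∀ x → P x)
∀⊎? P? = map′ (λ (p , q) → λ { (inj₁ i) → p i ; (inj₂ i) → q i })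
              (λ p → p ∘ inj₁ , p ∘ inj₂)
              (Fin.all? (P? ∘ inj₁) ×-dec Fin.all? (P? ∘ inj₂))

_≟⊎_ : DecidableEquality (Fin m ⊎ Fin m)
inj₁ i ≟⊎ inj₁ j = map′ (cong inj₁) (λ { refl → refl }) (i Fin.≟ j)
inj₁ i ≟⊎ inj₂ j = no λ ()
inj₂ i ≟⊎ inj₁ j = no λ ()
inj₂ i ≟⊎ inj₂ j = map′ (cong inj₂) (λ { refl → refl }) (i Fin.≟ j)

orientable? : ∀ n → Decidable (Orientable {k} {m} n)
orientable? n s =
  map′ (λ p {x} {y} → p x y) (λ p x y → p {x} {y})
       (∀⊎? λ x → ∀⊎? λ y → (_ ≟ˢ _) →-dec (x ≟⊎ y))

orientable⇒≤ : ∀ n (s : Str k m) → Orientable n s → m ≤ length (strings k n)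
orientable⇒≤ n s o =
  Fin.injective⇒≤ {f = λ t → Any.index (∈-strings (window n s t))} λ {i} {j} eq →
    inj₁-injective (o {inj₁ i} {inj₁ j}
      (trans (lookup-index (∈-strings (window n s i)))
        (trans (cong (List.lookup (strings _ n)) eq)
               (sym (lookup-index (∈-strings (window n s j)))))))

largest : {P : ℕ → Set} → Decidable P → P 0 → ∀ b →
          ∃[ m ] P m × (∀ l → l ≤ b → P l → l ≤ m)
largest P? p₀ zero = 0 , p₀ , λ _ l≤0 _ → l≤0
largest P? p₀ (suc b) with P? (suc b)
... | yes p = suc b , p , λ _ l≤b _ → l≤b
... | no ¬p with largest P? p₀ b
...   | m , pm , max = m , pm , λ l l≤1+b pl →
          max l (≤-pred (≤∧≢⇒< l≤1+b λ { refl → ¬p pl })) pl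

maxLength : ∀ k n → ∃ (IsMaxLength k n)
maxLength k n
  with largest {P = λ m → Σ[ s ∈ Str k m ] Orientable n s}
         (λ m → ∃-string? (orientable? n))
         ([] , λ { {inj₁ ()} ; {inj₂ ()} })
         (length (strings k n))
... | m , p , max = m , p , λ s o → max _ (orientable⇒≤ n s o) (s , o)

M : ℕ → ℕ → ℕ
M k n = proj₁ (maxLength k n)

M-isMaxLength : ∀ k n → IsMaxLength k n (M k n)
M-isMaxLength k n = proj₂ (maxLength k n)

{-# OPTIONS --safe #-}

-- For a cyclic word w let φ(w) be the number of cyclic factors 01 minus the
-- number of cyclic factors 10.  It is invariant under rotation and changes
-- sign under reversal, so T = {w : φ(w) > 0} is closed under rotation and
-- disjoint from its reversal.  Any two words of T are connected by rotations
-- and by changes of a single symbol that stay inside T: once one symbol is 2,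
-- the others can be turned into 2 one by one until only one factor 01 is left.
-- Joining cycles of the pure cycling register along these changes therefore
-- gives one cycle through T, that is, an orientable sequence of length |T|.
-- Words with φ(w) ≠ 0 are asymmetric, so both M and L lie between
-- (kⁿ - |Z|)/2 and kⁿ/2, where Z = {w : φ(w) = 0}.  Finally |Z| = o(kⁿ): almost
-- every word contains an aligned block from a list of r blocks that are
-- interchangeable and have r different contributions to φ.
module Submission where

open import Defs
open import Algebra.Properties.Semiring.Sum using (sum; sum-cong-≗; ∑-distrib-+; *-distribˡ-sum)
open import Data.Bool.Base using (if_then_else_)
open import Data.Fin.Base using (Fin; zero; suc; toℕ; inject₁; fromℕ; splitAt; join)
import Data.Fin.Properties as Fin
open import Data.Fin.Relation.Unary.Top using (view; ‵fromℕ; ‵inject₁)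
open import Data.Integer.Base as ℤ using (ℤ; 0ℤ; 1ℤ; -1ℤ) renaming (_+_ to _+ℤ_)
import Data.Integer.Properties as ℤ
open import Data.List.Base as List using (List; []; _∷_; _++_; [_]; map; filter; length; allFin; cartesianProduct; cartesianProductWith)
open import Data.List.Membership.Propositional using (_∈_)
open import Data.List.Membership.Propositional.Properties using (∈-lookup; ∈-filter⁺; ∈-filter⁻; ∈-cartesianProduct⁺; ∈-allFin)
import Data.List.Properties as List
open import Data.List.Relation.Unary.All as All using (All; []; _∷_)
open import Data.List.Relation.Unary.AllPairs using ([]; _∷_)
import Data.List.Relation.Unary.Any as Any
open import Data.List.Relation.Unary.Any.Properties using (lookup-index)
open import Data.List.Relation.Unary.Unique.Propositional using (Unique)
import Data.List.Relation.Unary.Unique.Propositional.Properties as Unique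
open import Data.Nat.Base
open import Data.Nat.DivMod
open import Data.Nat.GeneralisedArithmetic using (fold; fold-+)
open import Data.Nat.Properties
open import Data.Nat.Solver using (module +-*-Solver)
open import Data.Product.Base using (Σ-syntax; ∃-syntax; _×_; _,_; proj₁; proj₂; map₂; uncurry)
open import Data.Rational.Base as ℚ using (ℚ; 0ℚ; mkℚ)
import Data.Rational.Properties as ℚ
open import Data.Rational.Unnormalised.Base using (mkℚᵘ; *<*)
import Data.Rational.Unnormalised.Properties as ℚᵘ
open import Data.Sum.Base as Sum using (_⊎_; inj₁; inj₂)
open import Data.Vec.Base using (Vec; []; _∷_; _∷ʳ_; head; tail; lookup; tabulate; toList; replicate; reverse)
open import Data.Vec.Properties using (∷ʳ-injective; cast-is-id; length-toList; lookup∘tabulate; reverse-injective; reverse-involutive; reverse-∷; tabulate-cong; tabulate∘lookup; toList-injective; toList-replicate; toList-reverse; toList-∷ʳ)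
import Data.Vec.Relation.Binary.Lex.Strict as Lex
open import Data.Vec.Relation.Binary.Pointwise.Inductive using (Pointwise-≡⇒≡)
open import Function.Base using (_∘_; _∘′_; id)
open import Function.Definitions using (Injective)
open import Relation.Binary.Construct.Closure.ReflexiveTransitive using (Star; _◅_; _◅◅_) renaming (ε to stop)
open import Relation.Binary.Definitions using (DecidableEquality; tri<; tri≈; tri>)
open import Relation.Binary.PropositionalEquality hiding ([_])
open import Relation.Binary.Structures using (IsTotalOrder)
open import Relation.Nullary.Decidable using (Dec; yes; no; does; _⊎-dec_)
open import Relation.Nullary.Negation using (¬_; contradiction)
open import Relation.Unary using (Decidable)

-- Over two symbols the cyclic factors 01 and 10 alternate, so φ is identically zero; the third
-- symbol is what makes φ nontrivial, and this is where k ≥ 3 enters. The sign of φ chooses one word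
-- of each pair w, reverse w with φ(w) ≠ 0, and it does so for whole rotation classes at once, so
-- the pure cycling register can serve as the start of the construction. Instead of a spanning tree
-- of rotation classes, all changes of a single symbol are tried in turn. Exchanging the successors
-- of two words on different cycles merges the cycles, a pair on one cycle is skipped, and no join
-- ever separates words that are already connected. For Z, fix everything in a word except one
-- block: at most one of the r interchangeable blocks makes φ vanish. To stay within ℕ, words are
-- counted with weight r. The weighted count is at most (number of words) + r * (number of words
-- without such a block), and the share of the latter decays geometrically in the number of aligned
-- segments.

private
  variable
    k n : ℕ

-- Orbits

Reach : {A : Set} → (A → A) → A → A → Set
Reach F a b = ∃[ t ] fold a F t ≡ b

module _ {A : Set} {F : A → A} where

  reach-refl : ∀ {a} → Reach F a a
  reach-refl = 0 , refl

  reach-trans : ∀ {a b c} → Reach F a b → Reach F b c → Reach F a c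
  reach-trans {a} (s , refl) (t , refl) = t + s , fold-+ a F t

  reach-step : ∀ {a} → Reach F a (F a)
  reach-step = 1 , refl

  fold-injective : Injective _≡_ _≡_ F → ∀ t {a b} → fold a F t ≡ fold b F t → a ≡ b
  fold-injective inj zero    eq = eq
  fold-injective inj (suc t) eq = fold-injective inj t (inj eq)

  fold-cancel : Injective _≡_ _≡_ F → ∀ {a s t} → s < t → fold a F s ≡ fold a F t →
                ∃[ d ] suc s + d ≡ t × fold a F (suc d) ≡ a
  fold-cancel inj {a} {s} {t} s<t eq = t ∸ suc s , m+[n∸m]≡n s<t ,
    sym (fold-injective inj s (trans eq (trans (cong (fold a F) t≡) (fold-+ a F s))))
    where
    t≡ : t ≡ s + suc (t ∸ suc s)
    t≡ = trans (sym (m+[n∸m]≡n s<t)) (sym (+-suc s _))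

  fold-period : ∀ {a p} → fold a F p ≡ a → ∀ q s → fold a F (s + q * p) ≡ fold a F s
  fold-period         eq zero    s = cong (fold _ F) (+-identityʳ s)
  fold-period {a} {p} eq (suc q) s = begin
    fold a F (s + (p + q * p))          ≡⟨ cong (fold a F) (trans (cong (s +_) (+-comm p _)) (sym (+-assoc s _ p))) ⟩
    fold a F (s + q * p + p)            ≡⟨ fold-+ a F (s + q * p) ⟩
    fold (fold a F p) F (s + q * p)     ≡⟨ cong (λ x → fold x F (s + q * p)) eq ⟩
    fold a F (s + q * p)                ≡⟨ fold-period eq q s ⟩
    fold a F s                          ∎
    where open ≡-Reasoning

reach-mono : {A : Set} {F G : A → A} → (∀ a → Reach G a (F a)) →
             ∀ {a b} → Reach F a b → Reach G a b
reach-mono         step (zero  , refl) = reach-refl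
reach-mono {F = F} step {a} (suc t , refl) =
  reach-trans (reach-mono step (t , refl)) (step (fold a F t))

transpose : {A : Set} → DecidableEquality A → A → A → A → A
transpose _≟_ u v a with a ≟ u | a ≟ v
... | yes _ | _     = v
... | no _  | yes _ = u
... | no _  | no _  = a

module _ {A : Set} (_≟_ : DecidableEquality A) (u v : A) where

  transpose-left : transpose _≟_ u v u ≡ v
  transpose-left with u ≟ u
  ... | yes _ = refl
  ... | no ¬p = contradiction refl ¬p

  transpose-right : transpose _≟_ u v v ≡ u
  transpose-right with v ≟ u | v ≟ v
  ... | yes v≡u | _     = v≡u
  ... | no _    | yes _ = refl
  ... | no _    | no ¬p = contradiction refl ¬p

  transpose-other : ∀ {a} → a ≢ u → a ≢ v → transpose _≟_ u v a ≡ a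
  transpose-other {a} a≢u a≢v with a ≟ u | a ≟ v
  ... | yes p | _     = contradiction p a≢u
  ... | no _  | yes p = contradiction p a≢v
  ... | no _  | no _  = refl

  transpose-involutive : ∀ a → transpose _≟_ u v (transpose _≟_ u v a) ≡ a
  transpose-involutive a = go (a ≟ u) (a ≟ v)
    where
    go : Dec (a ≡ u) → Dec (a ≡ v) → transpose _≟_ u v (transpose _≟_ u v a) ≡ a
    go (yes refl) _          = trans (cong (transpose _≟_ u v) transpose-left) transpose-right
    go (no _)     (yes refl) = trans (cong (transpose _≟_ u v) transpose-right) transpose-left
    go (no p)     (no q)     = trans (cong (transpose _≟_ u v) (transpose-other p q)) (transpose-other p q)

  transpose-injective : Injective _≡_ _≡_ (transpose _≟_ u v)
  transpose-injective {a} {b} eq =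
    trans (sym (transpose-involutive a)) (trans (cong (transpose _≟_ u v) eq) (transpose-involutive b))

  transpose-elim : (P : A → A → Set) → P u v → P v u → (∀ a → P a a) → ∀ a → P a (transpose _≟_ u v a)
  transpose-elim P puv pvu paa a with a ≟ u | a ≟ v
  ... | yes refl | _        = puv
  ... | no _     | yes refl = pvu
  ... | no _     | no _     = paa a

module _ {A : Set} {N : ℕ} (code : A → Fin N) (code-injective : Injective _≡_ _≡_ code) where

  return-time : {F : A → A} → Injective _≡_ _≡_ F → ∀ a → ∃[ p ] fold a F (suc p) ≡ a
  return-time {F} inj a
    with i , j , i<j , eq ← Fin.pigeonhole (n<1+n N) (λ t → code (fold a F (toℕ t)))
    with d , _ , ret ← fold-cancel inj i<j (code-injective eq) = d , ret

  reach-sym : {F : A → A} → Injective _≡_ _≡_ F → ∀ {a b} → Reach F a b → Reach F b a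
  reach-sym {F} inj {a} (t , refl) with p , ret ← return-time inj a =
    -- `t * p` further steps make `t * suc p` in total, a multiple of the period `suc p`.
    t * p , trans (sym (fold-+ a F (t * p)))
                  (trans (cong (fold a F) (trans (+-comm (t * p) t) (sym (*-suc t p)))) (fold-period ret t 0))

  -- Composing with the transposition of two points on different cycles
  -- merges these two cycles.
  reach-join : (_≟_ : DecidableEquality A) {F : A → A} → Injective _≡_ _≡_ F → ∀ u v →
               Reach F u v ⊎ (Reach (F ∘ transpose _≟_ u v) u v ×
                              (∀ a → Reach (F ∘ transpose _≟_ u v) a (F a)))
  reach-join _≟_ {F} inj u v with p , ret ← return-time inj v
    with anyUpTo? (λ i → fold v F i ≟ u) (suc p)
  ... | yes (i , _ , eq) = inj₁ (reach-sym inj (i , eq))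
  ... | no ¬∃ = inj₂ (u⇝v , step)
    where
    G = F ∘ transpose _≟_ u v

    -- Here `u` is off the cycle of `v`: `G` jumps from `u` to `F v` and then follows that cycle. As
    -- `suc p` may be a multiple of the least period, `v` can recur early; the point after it is
    -- then `F v`, which is `G u`.
    u⇝F^v : ∀ i → i ≤ p → Reach G u (F (fold v F i))
    u⇝F^v zero    _   = 1 , cong F (transpose-left _≟_ u v)
    u⇝F^v (suc i) i<p with fold v F (suc i) ≟ v
    ... | yes eq rewrite eq = 1 , cong F (transpose-left _≟_ u v)
    ... | no ¬eq = reach-trans (u⇝F^v i (<⇒≤ i<p))
                     (1 , cong F (transpose-other _≟_ u v (λ eq → ¬∃ (suc i , s≤s i<p , eq)) ¬eq))

    u⇝v : Reach G u v
    u⇝v = subst (Reach G u) ret (u⇝F^v p ≤-refl)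

    step : ∀ a → Reach G a (F a)
    step a with a ≟ u | a ≟ v
    ... | yes refl | _        = reach-trans u⇝v (1 , cong F (transpose-right _≟_ u v))
    ... | no _     | yes refl =
      reach-trans (reach-sym (transpose-injective _≟_ u v ∘ inj) u⇝v) (1 , cong F (transpose-left _≟_ u v))
    ... | no p     | no q     = 1 , cong F (transpose-other _≟_ u v p q)

-- Winding numbers

pattern 𝟘 = zero
pattern 𝟙 = suc zero
pattern 𝟚 = suc (suc zero)

cross : Fin (3 + k) → Fin (3 + k) → ℤ
cross 𝟘 𝟙 = 1ℤ
cross 𝟙 𝟘 = -1ℤ
cross _ _ = 0ℤ

path : Fin (3 + k) → List (Fin (3 + k)) → ℤ
path x []      = 0ℤ
path x (y ∷ l) = cross x y +ℤ path y l

wind : List (Fin (3 + k)) → ℤ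
wind []      = 0ℤ
wind (x ∷ l) = path x (l ++ [ x ])

last′ : Fin (3 + k) → List (Fin (3 + k)) → Fin (3 + k)
last′ x []      = x
last′ x (y ∷ l) = last′ y l

cross-antisym : (x y : Fin (3 + k)) → cross x y ≡ ℤ.- cross y x
cross-antisym 𝟘 𝟘 = refl
cross-antisym 𝟘 𝟙 = refl
cross-antisym 𝟘 (suc (suc _)) = refl
cross-antisym 𝟙 𝟘 = refl
cross-antisym 𝟙 𝟙 = refl
cross-antisym 𝟙 (suc (suc _)) = refl
cross-antisym (suc (suc _)) 𝟘 = refl
cross-antisym (suc (suc _)) 𝟙 = refl
cross-antisym (suc (suc _)) (suc (suc _)) = refl

cross-suc²ˡ : (s : Fin (suc k)) (y : Fin (3 + k)) → cross (suc (suc s)) y ≡ 0ℤ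
cross-suc²ˡ s 𝟘 = refl
cross-suc²ˡ s (suc _) = refl

cross-suc²ʳ : (x : Fin (3 + k)) (s : Fin (suc k)) → cross x (suc (suc s)) ≡ 0ℤ
cross-suc²ʳ x s = trans (cross-antisym x (suc (suc s))) (cong ℤ.-_ (cross-suc²ˡ s x))

cross-0-≤ : (y : Fin (3 + k)) → cross 𝟘 y ℤ.≤ 1ℤ
cross-0-≤ 𝟘 = ℤ.+≤+ z≤n
cross-0-≤ 𝟙 = ℤ.≤-refl
cross-0-≤ (suc (suc _)) = ℤ.+≤+ z≤n

cross-1-≤ : (y : Fin (3 + k)) → cross 𝟙 y ℤ.≤ 0ℤ
cross-1-≤ 𝟘 = ℤ.-≤+
cross-1-≤ (suc _) = ℤ.≤-refl

path-++ : (x : Fin (3 + k)) (u v : List (Fin (3 + k))) →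
          path x (u ++ v) ≡ path x u +ℤ path (last′ x u) v
path-++ x []      v = sym (ℤ.+-identityˡ _)
path-++ x (y ∷ u) v = trans (cong (cross x y +ℤ_) (path-++ y u v)) (sym (ℤ.+-assoc (cross x y) _ _))

last′-++ : (x : Fin (3 + k)) (u : List (Fin (3 + k))) (y : Fin (3 + k)) (v : List (Fin (3 + k))) →
           last′ x (u ++ y ∷ v) ≡ last′ y v
last′-++ x []      y v = refl
last′-++ x (z ∷ u) y v = last′-++ z u y v

path-∷ʳ∷ʳ : (x : Fin (3 + k)) (u : List (Fin (3 + k))) (y z : Fin (3 + k)) →
            path x ((u ++ [ y ]) ++ [ z ]) ≡ path x (u ++ [ y ]) +ℤ cross y z
path-∷ʳ∷ʳ x u y z = trans (path-++ x (u ++ [ y ]) [ z ])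
  (cong (path x (u ++ [ y ]) +ℤ_)
    (trans (cong (λ p → cross p z +ℤ 0ℤ) (last′-++ x u y [])) (ℤ.+-identityʳ _)))

path-reverse : (x : Fin (3 + k)) (l : List (Fin (3 + k))) (z : Fin (3 + k)) →
               path z (List.reverse l ++ [ x ]) ≡ ℤ.- path x (l ++ [ z ])
path-reverse x []      z = trans (ℤ.+-identityʳ _) (trans (cross-antisym z x) (cong ℤ.-_ (sym (ℤ.+-identityʳ _))))
path-reverse x (y ∷ l) z = begin
  path z (List.reverse (y ∷ l) ++ [ x ])             ≡⟨ cong (λ m → path z (m ++ [ x ])) (List.unfold-reverse y l) ⟩
  path z ((List.reverse l ++ [ y ]) ++ [ x ])        ≡⟨ path-∷ʳ∷ʳ z (List.reverse l) y x ⟩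
  path z (List.reverse l ++ [ y ]) +ℤ cross y x     ≡⟨ cong₂ _+ℤ_ (path-reverse y l z) (cross-antisym y x) ⟩
  ℤ.- path y (l ++ [ z ]) +ℤ ℤ.- cross x y     ≡⟨ ℤ.+-comm (ℤ.- path y (l ++ [ z ])) _ ⟩
  ℤ.- cross x y +ℤ ℤ.- path y (l ++ [ z ])     ≡⟨ ℤ.neg-distrib-+ (cross x y) _ ⟨
  ℤ.- (cross x y +ℤ path y (l ++ [ z ]))       ∎
  where open ≡-Reasoning

wind-rotate₁ : (x : Fin (3 + k)) (l : List (Fin (3 + k))) → wind (l ++ [ x ]) ≡ wind (x ∷ l)
wind-rotate₁ x []      = refl
wind-rotate₁ x (y ∷ l) = trans (path-∷ʳ∷ʳ y l x y) (ℤ.+-comm _ (cross x y))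

wind-rotate : (u v : List (Fin (3 + k))) → wind (v ++ u) ≡ wind (u ++ v)
wind-rotate []      v = cong wind (List.++-identityʳ v)
wind-rotate (x ∷ u) v = begin
  wind (v ++ x ∷ u)          ≡⟨ cong wind (List.++-assoc v [ x ] u) ⟨
  wind ((v ++ [ x ]) ++ u)   ≡⟨ wind-rotate u (v ++ [ x ]) ⟩
  wind (u ++ v ++ [ x ])     ≡⟨ cong wind (List.++-assoc u v [ x ]) ⟨
  wind ((u ++ v) ++ [ x ])   ≡⟨ wind-rotate₁ x (u ++ v) ⟩
  wind (x ∷ u ++ v)          ∎
  where open ≡-Reasoning

wind-reverse : (l : List (Fin (3 + k))) → wind (List.reverse l) ≡ ℤ.- wind l
wind-reverse []      = refl
wind-reverse (x ∷ l) = begin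
  wind (List.reverse (x ∷ l))      ≡⟨ cong wind (List.unfold-reverse x l) ⟩
  wind (List.reverse l ++ [ x ])   ≡⟨ wind-rotate₁ x (List.reverse l) ⟩
  wind (x ∷ List.reverse l)        ≡⟨ path-reverse x l x ⟩
  ℤ.- wind (x ∷ l)            ∎
  where open ≡-Reasoning

-- Reduction of positive words to 01 followed by 2s

infix 4 _⟶_ _⟶*_
-- Words are lists here, so that cutting and regluing cyclic words involves no length indices. Both
-- constructors preserve the length, and `⟶*-reach` carries the steps back to vectors.
data _⟶_ {k} : List (Fin (3 + k)) → List (Fin (3 + k)) → Set where
  rotate₁ : ∀ x l → x ∷ l ⟶ l ++ [ x ]
  change  : ∀ x y l → 0ℤ ℤ.< wind (x ∷ l) → 0ℤ ℤ.< wind (y ∷ l) → x ∷ l ⟶ y ∷ l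

_⟶*_ : List (Fin (3 + k)) → List (Fin (3 + k)) → Set
_⟶*_ = Star _⟶_

≡⇒⟶* : {l m : List (Fin (3 + k))} → l ≡ m → l ⟶* m
≡⇒⟶* refl = stop

rotate* : (u v : List (Fin (3 + k))) → u ++ v ⟶* v ++ u
rotate* []      v = ≡⇒⟶* (sym (List.++-identityʳ v))
rotate* (x ∷ u) v = rotate₁ x (u ++ v) ◅
  (≡⇒⟶* (List.++-assoc u v [ x ]) ◅◅ rotate* u (v ++ [ x ]) ◅◅ ≡⇒⟶* (List.++-assoc v [ x ] u))

change* : ∀ (u : List (Fin (3 + k))) x y v → 0ℤ ℤ.< wind (u ++ x ∷ v) → 0ℤ ℤ.< wind (u ++ y ∷ v) →
          u ++ x ∷ v ⟶* u ++ y ∷ v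
change* u x y v px py =
  rotate* u (x ∷ v) ◅◅
  change x y (v ++ u) (subst (0ℤ ℤ.<_) (sym (wind-rotate u (x ∷ v))) px)
                      (subst (0ℤ ℤ.<_) (sym (wind-rotate u (y ∷ v))) py) ◅
  rotate* (y ∷ v) u

-- A `2` cuts the cyclic word open: no factor 01 or 10 contains it. Behind a leading `2` the winding
-- number is therefore a sum along a path, which splits over prefix and suffix.
wind-2∷ : (l : List (Fin (3 + k))) → wind (𝟚 ∷ l) ≡ path 𝟚 l
wind-2∷ l = trans (path-++ 𝟚 l [ 𝟚 ])
  (trans (cong (path 𝟚 l +ℤ_) (trans (ℤ.+-identityʳ _) (cross-suc²ʳ (last′ 𝟚 l) zero))) (ℤ.+-identityʳ _))

path-suc² : (s : Fin (suc k)) (l : List (Fin (3 + k))) → path (suc (suc s)) l ≡ path 𝟚 l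
path-suc² s []      = refl
path-suc² s (y ∷ l) = cong (_+ℤ path y l) (trans (cross-suc²ˡ s y) (sym (cross-suc²ˡ zero y)))

wind-suc²∷ : (s : Fin (suc k)) (l : List (Fin (3 + k))) → wind (suc (suc s) ∷ l) ≡ wind (𝟚 ∷ l)
wind-suc²∷ s l = begin
  path (suc (suc s)) (l ++ [ suc (suc s) ])                            ≡⟨ path-suc² s (l ++ [ suc (suc s) ]) ⟩
  path 𝟚 (l ++ [ suc (suc s) ])                                        ≡⟨ path-++ 𝟚 l [ suc (suc s) ] ⟩
  path 𝟚 l +ℤ (cross (last′ 𝟚 l) (suc (suc s)) +ℤ 0ℤ)
    ≡⟨ cong (λ c → path 𝟚 l +ℤ (c +ℤ 0ℤ)) (trans (cross-suc²ʳ (last′ 𝟚 l) s) (sym (cross-suc²ʳ (last′ 𝟚 l) zero))) ⟩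
  path 𝟚 l +ℤ (cross (last′ 𝟚 l) 𝟚 +ℤ 0ℤ)                            ≡⟨ path-++ 𝟚 l [ 𝟚 ] ⟨
  path 𝟚 (l ++ [ 𝟚 ])                                                  ∎
  where open ≡-Reasoning

path-1-≤ : (l : List (Fin (3 + k))) → path 𝟙 l ℤ.≤ path 𝟚 l
path-1-≤ []      = ℤ.≤-refl
path-1-≤ (y ∷ l) = ℤ.+-monoˡ-≤ (path y l) (subst (cross 𝟙 y ℤ.≤_) (sym (cross-suc²ˡ zero y)) (cross-1-≤ y))

path-0-≤ : (l : List (Fin (3 + k))) → -1ℤ +ℤ path 𝟘 l ℤ.≤ path 𝟚 l
path-0-≤ []      = ℤ.-≤+
path-0-≤ (y ∷ l) = begin
  -1ℤ +ℤ (cross 𝟘 y +ℤ path y l)   ≡⟨ ℤ.+-assoc -1ℤ (cross 𝟘 y) (path y l) ⟨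
  -1ℤ +ℤ cross 𝟘 y +ℤ path y l     ≤⟨ ℤ.+-monoˡ-≤ (path y l) (ℤ.+-monoʳ-≤ -1ℤ (cross-0-≤ y)) ⟩
  0ℤ +ℤ path y l                    ≡⟨ cong (_+ℤ path y l) (cross-suc²ˡ zero y) ⟨
  cross 𝟚 y +ℤ path y l             ∎
  where open ℤ.≤-Reasoning

-- Concatenations of the blocks 2 and 01, the form in which every 0 comes with a 1 that compensates
-- for a possible factor 10 before it.
data Clean {k} : List (Fin (3 + k)) → Set where
  []    : Clean []
  𝟚∷_   : ∀ {l} → Clean l → Clean (𝟚 ∷ l)
  𝟘∷𝟙∷_ : ∀ {l} → Clean l → Clean (𝟘 ∷ 𝟙 ∷ l)

wind-2∷++-mono : ∀ (u v w : List (Fin (3 + k))) {p} → last′ 𝟚 u ≡ p → path p v ℤ.≤ path p w →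
                 0ℤ ℤ.< wind (𝟚 ∷ u ++ v) → 0ℤ ℤ.< wind (𝟚 ∷ u ++ w)
wind-2∷++-mono u v w refl v≤w pos = begin-strict
  0ℤ                                    <⟨ pos ⟩
  wind (𝟚 ∷ u ++ v)                     ≡⟨ trans (wind-2∷ (u ++ v)) (path-++ 𝟚 u v) ⟩
  path 𝟚 u +ℤ path (last′ 𝟚 u) v       ≤⟨ ℤ.+-monoʳ-≤ (path 𝟚 u) v≤w ⟩
  path 𝟚 u +ℤ path (last′ 𝟚 u) w       ≡⟨ trans (wind-2∷ (u ++ w)) (path-++ 𝟚 u w) ⟨
  wind (𝟚 ∷ u ++ w)                     ∎
  where open ℤ.≤-Reasoning

path-∷2∷ : (p : Fin (3 + k)) (v : List (Fin (3 + k))) → path p (𝟚 ∷ v) ≡ path 𝟚 v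
path-∷2∷ p v = trans (cong (_+ℤ path 𝟚 v) (cross-suc²ʳ p zero)) (ℤ.+-identityˡ _)

-- A scan from left to right turns each symbol into `2`, sparing only a 01 that follows a symbol ≥
-- 2. Since the symbol before `γ` is nonzero, a `1` read next does not complete a factor 01, and no
-- replacement lowers the winding number.
clean-up : ∀ (u γ : List (Fin (3 + k))) {p} → last′ 𝟚 u ≡ suc p → 0ℤ ℤ.< wind (𝟚 ∷ u ++ γ) →
           ∃[ δ ] Clean δ × (𝟚 ∷ u ++ γ ⟶* 𝟚 ∷ u ++ δ) × 0ℤ ℤ.< wind (𝟚 ∷ u ++ δ)

clean-up-2 : ∀ (u : List (Fin (3 + k))) x γ {p} → last′ 𝟚 u ≡ suc p →
             path (suc p) (x ∷ γ) ℤ.≤ path 𝟚 γ → 0ℤ ℤ.< wind (𝟚 ∷ u ++ x ∷ γ) →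
             ∃[ δ ] Clean δ × (𝟚 ∷ u ++ x ∷ γ ⟶* 𝟚 ∷ u ++ δ) × 0ℤ ℤ.< wind (𝟚 ∷ u ++ δ)
clean-up-2 u x γ {p} eq le pos
  with pos′ ← wind-2∷++-mono u (x ∷ γ) (𝟚 ∷ γ) eq (ℤ.≤-trans le (ℤ.≤-reflexive (sym (path-∷2∷ (suc p) γ)))) pos
  with δ , δ-clean , steps , posδ ← clean-up (u ++ [ 𝟚 ]) γ (last′-++ 𝟚 u 𝟚 [])
                         (subst (λ l → 0ℤ ℤ.< wind (𝟚 ∷ l)) (sym (List.++-assoc u [ 𝟚 ] γ)) pos′)
  = 𝟚 ∷ δ , 𝟚∷ δ-clean ,
    change* (𝟚 ∷ u) x 𝟚 γ pos pos′ ◅◅ subst₂ (λ l m → 𝟚 ∷ l ⟶* 𝟚 ∷ m) (List.++-assoc u [ 𝟚 ] γ) (List.++-assoc u [ 𝟚 ] δ) steps ,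
    subst (λ l → 0ℤ ℤ.< wind (𝟚 ∷ l)) (List.++-assoc u [ 𝟚 ] δ) posδ

clean-up u [] eq pos = [] , [] , stop , pos
clean-up u (suc (suc s) ∷ γ) {p} eq pos = clean-up-2 u _ γ eq
  (ℤ.≤-reflexive (trans (cong (_+ℤ _) (cross-suc²ʳ (suc p) s)) (trans (ℤ.+-identityˡ _) (path-suc² s γ)))) pos
clean-up u (𝟙 ∷ γ) {p} eq pos = clean-up-2 u 𝟙 γ eq
  (subst (ℤ._≤ _) (sym (trans (cong (_+ℤ path 𝟙 γ) (cross-suc-1 p)) (ℤ.+-identityˡ _))) (path-1-≤ γ)) pos
  where
  cross-suc-1 : (p : Fin (2 + k)) → cross (suc p) 𝟙 ≡ 0ℤ
  cross-suc-1 zero    = refl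
  cross-suc-1 (suc _) = refl
-- This `0` follows a `1`: destroying the factor 10 gains one, which pays for the factor 01 that may
-- be lost behind it.
clean-up u (𝟘 ∷ γ) {zero} eq pos = clean-up-2 u 𝟘 γ eq (path-0-≤ γ) pos
clean-up u (𝟘 ∷ []) {suc _} eq pos = clean-up-2 u 𝟘 [] eq ℤ.≤-refl pos
clean-up u (𝟘 ∷ 𝟘 ∷ γ) {suc _} eq pos = clean-up-2 u 𝟘 (𝟘 ∷ γ) eq (ℤ.≤-reflexive (ℤ.+-identityˡ _)) pos
clean-up u (𝟘 ∷ suc (suc s) ∷ γ) {suc _} eq pos = clean-up-2 u 𝟘 (suc (suc s) ∷ γ) eq (ℤ.≤-reflexive (ℤ.+-identityˡ _)) pos
clean-up u (𝟘 ∷ 𝟙 ∷ γ) {suc _} eq pos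
  with δ , δ-clean , steps , posδ ← clean-up (u ++ 𝟘 ∷ 𝟙 ∷ []) γ (last′-++ 𝟚 u 𝟘 [ 𝟙 ])
                         (subst (λ l → 0ℤ ℤ.< wind (𝟚 ∷ l)) (sym (List.++-assoc u (𝟘 ∷ 𝟙 ∷ []) γ)) pos)
  = 𝟘 ∷ 𝟙 ∷ δ , 𝟘∷𝟙∷ δ-clean ,
    subst₂ (λ l m → 𝟚 ∷ l ⟶* 𝟚 ∷ m) (List.++-assoc u (𝟘 ∷ 𝟙 ∷ []) γ) (List.++-assoc u (𝟘 ∷ 𝟙 ∷ []) δ) steps ,
    subst (λ l → 0ℤ ℤ.< wind (𝟚 ∷ l)) (List.++-assoc u (𝟘 ∷ 𝟙 ∷ []) δ) posδ

-- A factor 10 can arise only where a block 01 follows a `1`, and the 01 of that block offsets it.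
path-clean : {l : List (Fin (3 + k))} → Clean l → ∀ p → 0ℤ ℤ.≤ path (suc p) l
path-clean [] p = ℤ.≤-refl
path-clean (𝟚∷_ {l} c) p = subst (0ℤ ℤ.≤_) (sym (path-∷2∷ (suc p) l)) (path-clean c _)
path-clean (𝟘∷𝟙∷_ {l} c) zero = subst (0ℤ ℤ.≤_)
  (trans (sym (ℤ.+-identityˡ _)) (ℤ.+-assoc -1ℤ 1ℤ (path 𝟙 l))) (path-clean c _)
path-clean (𝟘∷𝟙∷_ {l} c) (suc s) = ℤ.≤-trans (path-clean c _)
  (ℤ.≤-trans (ℤ.i≤suc[i] (path 𝟙 l)) (ℤ.≤-reflexive (sym (ℤ.+-identityˡ _))))

wind-clean : ∀ (u : List (Fin (3 + k))) {l p} → last′ 𝟚 u ≡ suc p → 0ℤ ℤ.< path 𝟚 u → 0ℤ ℤ.≤ path (suc p) l →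
             0ℤ ℤ.< wind (𝟚 ∷ u ++ l)
wind-clean u {l} eq pos nonneg = subst (0ℤ ℤ.<_)
  (sym (trans (wind-2∷ (u ++ l)) (trans (path-++ 𝟚 u l) (cong (λ q → path 𝟚 u +ℤ path q l) eq))))
  (ℤ.+-mono-<-≤ pos nonneg)

path-replicate : ∀ i (l : List (Fin (3 + k))) → path 𝟚 (List.replicate i 𝟚 ++ l) ≡ path 𝟚 l
path-replicate zero    l = refl
path-replicate (suc i) l = trans (ℤ.+-identityˡ _) (path-replicate i l)

replicate-++ : ∀ {A : Set} i j {x : A} → List.replicate i x ++ List.replicate j x ≡ List.replicate (i + j) x
replicate-++ zero    j = refl
replicate-++ (suc i) j = cong (_ ∷_) (replicate-++ i j)

last′-replicate : ∀ i → last′ {k} 𝟚 (List.replicate i 𝟚) ≡ 𝟚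
last′-replicate zero    = refl
last′-replicate (suc i) = last′-replicate i

path-++-replicate : ∀ (u : List (Fin (3 + k))) i → path 𝟚 (u ++ List.replicate (suc i) 𝟚) ≡ path 𝟚 u
path-++-replicate u i = begin
  path 𝟚 (u ++ List.replicate (suc i) 𝟚)                        ≡⟨ path-++ 𝟚 u (List.replicate (suc i) 𝟚) ⟩
  path 𝟚 u +ℤ path (last′ 𝟚 u) (𝟚 ∷ List.replicate i 𝟚)
    ≡⟨ cong (path 𝟚 u +ℤ_) (trans (path-∷2∷ (last′ 𝟚 u) (List.replicate i 𝟚)) (cong (path 𝟚) (sym (List.++-identityʳ (List.replicate i 𝟚))))) ⟩
  path 𝟚 u +ℤ path 𝟚 (List.replicate i 𝟚 ++ [])                 ≡⟨ cong (path 𝟚 u +ℤ_) (path-replicate i []) ⟩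
  path 𝟚 u +ℤ 0ℤ                                           ≡⟨ ℤ.+-identityʳ _ ⟩
  path 𝟚 u                                                 ∎
  where open ≡-Reasoning

-- The prefix `u` alone supplies a positive amount, and by `path-clean` what remains of `γ` never
-- takes any of it away, so all intermediate words stay positive.
erase : ∀ (u : List (Fin (3 + k))) {γ p} → last′ 𝟚 u ≡ suc p → 0ℤ ℤ.< path 𝟚 u → Clean γ →
        ∃[ j ] (𝟚 ∷ u ++ γ ⟶* 𝟚 ∷ u ++ List.replicate j 𝟚)

erase-after : ∀ (u : List (Fin (3 + k))) i {γ} → 0ℤ ℤ.< path 𝟚 u → Clean γ →
              ∃[ j ] (𝟚 ∷ u ++ List.replicate (suc i) 𝟚 ++ γ ⟶* 𝟚 ∷ u ++ List.replicate j 𝟚)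
erase-after u i {γ} pos c
  with j , steps ← erase (u ++ List.replicate (suc i) 𝟚) {γ}
                     (trans (last′-++ 𝟚 u 𝟚 (List.replicate i 𝟚)) (last′-replicate i))
                     (subst (0ℤ ℤ.<_) (sym (path-++-replicate u i)) pos) c
  = suc i + j , subst₂ (λ l m → 𝟚 ∷ l ⟶* 𝟚 ∷ m) (List.++-assoc u (List.replicate (suc i) 𝟚) γ)
      (trans (List.++-assoc u (List.replicate (suc i) 𝟚) (List.replicate j 𝟚)) (cong (u ++_) (replicate-++ (suc i) j))) steps

erase u eq pos [] = 0 , stop
erase u eq pos (𝟚∷ c) = erase-after u 0 pos c
erase u {p = p} eq pos (𝟘∷𝟙∷_ {γ} c) =
  let
    pos₀ = wind-clean u {𝟘 ∷ 𝟙 ∷ γ} eq pos (path-clean (𝟘∷𝟙∷ c) p)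
    pos₁ = wind-clean u {𝟚 ∷ 𝟙 ∷ γ} eq pos
             (subst (0ℤ ℤ.≤_) (sym (trans (path-∷2∷ (suc p) (𝟙 ∷ γ)) (ℤ.+-identityˡ _))) (path-clean c _))
    pos₂ = wind-clean u {𝟚 ∷ 𝟚 ∷ γ} eq pos (path-clean (𝟚∷ 𝟚∷ c) p)
    j , steps = erase-after u 1 pos c
  in
    -- The `0` has to go before the `1`: if `u` ends in `1`, the pair 02 would leave a factor 10
    -- without compensation.
    j , change* (𝟚 ∷ u) 𝟘 𝟚 (𝟙 ∷ γ) pos₀ pos₁ ◅◅
        ≡⇒⟶* (cong (𝟚 ∷_) (sym (List.++-assoc u [ 𝟚 ] (𝟙 ∷ γ)))) ◅◅
        change* (𝟚 ∷ u ++ [ 𝟚 ]) 𝟙 𝟚 γ (subst (λ l → 0ℤ ℤ.< wind (𝟚 ∷ l)) (sym (List.++-assoc u [ 𝟚 ] (𝟙 ∷ γ))) pos₁)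
                                       (subst (λ l → 0ℤ ℤ.< wind (𝟚 ∷ l)) (sym (List.++-assoc u [ 𝟚 ] (𝟚 ∷ γ))) pos₂) ◅◅
        ≡⇒⟶* (cong (𝟚 ∷_) (List.++-assoc u [ 𝟚 ] (𝟚 ∷ γ))) ◅◅ steps

-- Leading 2s are collected in `i` up to the first block 01. That block keeps the word positive
-- while `erase` removes all later ones; a rotation then brings it to the front.
clean⟶* : ∀ i {γ : List (Fin (3 + k))} → Clean γ → 0ℤ ℤ.< path 𝟚 γ →
          ∃[ m ] (List.replicate (suc i) 𝟚 ++ γ ⟶* 𝟘 ∷ 𝟙 ∷ List.replicate m 𝟚)
clean⟶* i [] (ℤ.+<+ ())
clean⟶* i (𝟚∷_ {γ} c) pos
  with m , steps ← clean⟶* (suc i) c (subst (0ℤ ℤ.<_) (ℤ.+-identityˡ _) pos)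
  = m , ≡⇒⟶* (trans (sym (List.++-assoc (List.replicate (suc i) 𝟚) [ 𝟚 ] γ))
                    (cong (_++ γ) (trans (replicate-++ (suc i) 1) (cong (λ n → List.replicate n 𝟚) (+-comm (suc i) 1))))) ◅◅ steps
clean⟶* {k} i (𝟘∷𝟙∷_ {γ} c) pos
  with j , steps ← erase (List.replicate i 𝟚 ++ 𝟘 ∷ 𝟙 ∷ []) (last′-++ 𝟚 (List.replicate i 𝟚) 𝟘 [ 𝟙 ])
                     (subst (0ℤ ℤ.<_) (sym (path-replicate {k} i (𝟘 ∷ 𝟙 ∷ []))) (ℤ.+<+ (s≤s z≤n))) c
  = j + suc i ,
    ≡⇒⟶* (cong (𝟚 ∷_) (sym (List.++-assoc (List.replicate i 𝟚) (𝟘 ∷ 𝟙 ∷ []) γ))) ◅◅ steps ◅◅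
    ≡⇒⟶* (cong (𝟚 ∷_) (List.++-assoc (List.replicate i 𝟚) (𝟘 ∷ 𝟙 ∷ []) _)) ◅◅
    rotate* (List.replicate (suc i) 𝟚) (𝟘 ∷ 𝟙 ∷ List.replicate j 𝟚) ◅◅
    ≡⇒⟶* (cong (λ l → 𝟘 ∷ 𝟙 ∷ l) (replicate-++ j (suc i)))

data Binary {k} : Fin (3 + k) → ℤ → Set where
  is0 : Binary 𝟘 0ℤ
  is1 : Binary 𝟙 1ℤ

-- On binary symbols cross x y = y - x, so paths telescope.
cross-binary : ∀ {x y : Fin (3 + k)} {a b} → Binary x a → Binary y b → a +ℤ cross x y ≡ b
cross-binary is0 is0 = refl
cross-binary is0 is1 = refl
cross-binary is1 is0 = refl
cross-binary is1 is1 = refl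

path-binary : ∀ {x z : Fin (3 + k)} {a b} l → Binary x a → Binary z b →
              (∃[ u ] ∃[ s ] ∃[ v ] l ≡ u ++ suc (suc s) ∷ v) ⊎ a +ℤ path x (l ++ [ z ]) ≡ b
path-binary {x = x} {z} {a} [] bx bz = inj₂ (trans (cong (a +ℤ_) (ℤ.+-identityʳ (cross x z))) (cross-binary bx bz))
path-binary {k} {x} {z} {a} {b} (y ∷ l) bx bz = go y
  where
  binary : ∀ y {c} → Binary y c →
           (∃[ u ] ∃[ s ] ∃[ v ] y ∷ l ≡ u ++ suc (suc s) ∷ v) ⊎ a +ℤ path x (y ∷ l ++ [ z ]) ≡ b
  binary y by with path-binary l by bz
  ... | inj₁ (u , s , v , eq) = inj₁ (y ∷ u , s , v , cong (y ∷_) eq)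
  ... | inj₂ eq = inj₂ (trans (sym (ℤ.+-assoc a (cross x y) _))
                              (trans (cong (_+ℤ path y (l ++ [ z ])) (cross-binary bx by)) eq))

  go : ∀ y → (∃[ u ] ∃[ s ] ∃[ v ] y ∷ l ≡ u ++ suc (suc s) ∷ v) ⊎ a +ℤ path x (y ∷ l ++ [ z ]) ≡ b
  go 𝟘 = binary 𝟘 is0
  go 𝟙 = binary 𝟙 is1
  go (suc (suc s)) = inj₁ ([] , s , l , refl)

-- If only 0 and 1 occurred, the path around the cycle would telescope to zero. The symbol found
-- here is the place where `clean-up` starts.
nonbinary : ∀ (l : List (Fin (3 + k))) → 0ℤ ℤ.< wind l → ∃[ u ] ∃[ s ] ∃[ v ] l ≡ u ++ suc (suc s) ∷ v
nonbinary [] (ℤ.+<+ ())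
nonbinary (suc (suc s) ∷ l) pos = [] , s , l , refl
nonbinary (𝟘 ∷ l) pos with path-binary l is0 is0
... | inj₁ (u , s , v , refl) = 𝟘 ∷ u , s , v , refl
... | inj₂ eq = contradiction (trans (sym (ℤ.+-identityˡ _)) eq) (ℤ.<⇒≢ pos ∘′ sym)
nonbinary (𝟙 ∷ l) pos with path-binary l is1 is1
... | inj₁ (u , s , v , refl) = 𝟙 ∷ u , s , v , refl
... | inj₂ eq = contradiction (trans (sym (ℤ.pred-suc _)) (cong ℤ.pred eq)) (ℤ.<⇒≢ pos ∘′ sym)

wind>0⇒⟶* : ∀ (l : List (Fin (3 + k))) → 0ℤ ℤ.< wind l → ∃[ m ] (l ⟶* 𝟘 ∷ 𝟙 ∷ List.replicate m 𝟚)
wind>0⇒⟶* l pos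
  with u , s , v , refl ← nonbinary l pos
  with pos₁ ← subst (0ℤ ℤ.<_) (sym (wind-rotate u (suc (suc s) ∷ v))) pos
  with pos₂ ← subst (0ℤ ℤ.<_) (wind-suc²∷ s (v ++ u)) pos₁
  with δ , δ-clean , steps , posδ ← clean-up [] (v ++ u) refl pos₂
  with m , steps′ ← clean⟶* 0 δ-clean (subst (0ℤ ℤ.<_) (wind-2∷ δ) posδ)
  = m , (rotate* u (suc (suc s) ∷ v) ◅◅ change _ 𝟚 (v ++ u) pos₁ pos₂ ◅ (steps ◅◅ steps′))

-- The orientable sequence

rot : {A : Set} → Vec A n → Vec A n
rot []      = []
rot (x ∷ β) = β ∷ʳ x

rot-injective : {A : Set} → Injective _≡_ _≡_ (rot {n} {A})
rot-injective {x = []}    {[]}    _  = refl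
rot-injective {x = x ∷ β} {y ∷ γ} eq with refl , refl ← ∷ʳ-injective β γ eq = refl

winding : Str (3 + k) n → ℤ
winding w = wind (toList w)

winding-rot : (w : Str (3 + k) n) → winding (rot w) ≡ winding w
winding-rot []      = refl
winding-rot (x ∷ β) = trans (cong wind (toList-∷ʳ x β)) (wind-rotate₁ x (toList β))

winding-reverse : (w : Str (3 + k) n) → winding (reverse w) ≡ ℤ.- winding w
winding-reverse w = trans (cong wind (toList-reverse w)) (wind-reverse (toList w))

Positive : Str (3 + k) n → Set
Positive w = 0ℤ ℤ.< winding w

positive? : Decidable (Positive {k} {n})
positive? w = 0ℤ ℤ.<? winding w

position : Str k n → Fin (length (strings k n))
position w = Any.index (∈-strings w)

position-injective : Injective _≡_ _≡_ (position {k} {n})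
position-injective {x = v} {w} eq =
  trans (lookup-index (∈-strings v)) (trans (cong (List.lookup (strings _ _)) eq) (sym (lookup-index (∈-strings w))))

-- A nonsingular feedback shift register that preserves T. The field `rotates` says that each of its
-- cycles is a union of rotation classes; it is the invariant that makes rotation steps available
-- after any number of joins.
record SuccessorRule (F : Str (3 + k) (suc n) → Str (3 + k) (suc n)) : Set where
  field
    injective : Injective _≡_ _≡_ F
    shifts    : ∀ w → ∃[ z ] F w ≡ tail w ∷ʳ z
    positive  : ∀ w → Positive w → Positive (F w)
    rotates   : ∀ w → Reach F w (rot w)

open SuccessorRule

rot-rule : SuccessorRule (rot {suc n} {Fin (3 + k)})
rot-rule .injective = rot-injective
rot-rule .shifts (x ∷ β) = x , refl
rot-rule .positive w pos = subst (0ℤ ℤ.<_) (sym (winding-rot w)) pos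
rot-rule .rotates w = reach-step

-- Both words have the tail `β`, so exchanging their successors still yields a shift register, and
-- as both are positive the exchange does not lead out of T.
join-rule : {F : Str (3 + k) (suc n) → Str (3 + k) (suc n)} → SuccessorRule F →
            ∀ x y β → Positive (x ∷ β) → Positive (y ∷ β) →
            ∃[ G ] SuccessorRule G × Reach G (x ∷ β) (y ∷ β) × (∀ a → Reach G a (F a))
join-rule {F = F} rule x y β px py
  with reach-join position position-injective _≟ˢ_ (rule .injective) (x ∷ β) (y ∷ β)
... | inj₁ xy = F , rule , xy , λ _ → reach-step
... | inj₂ (xy , steps) = F ∘ τ , rule′ , xy , steps
  where
  τ = transpose _≟ˢ_ (x ∷ β) (y ∷ β)

  rule′ : SuccessorRule (F ∘ τ)
  rule′ .injective = transpose-injective _≟ˢ_ _ _ ∘ rule .injective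
  rule′ .shifts w =
    transpose-elim _≟ˢ_ (x ∷ β) (y ∷ β) (λ v w → ∃[ z ] F w ≡ tail v ∷ʳ z)
      (rule .shifts (y ∷ β)) (rule .shifts (x ∷ β)) (rule .shifts) w
  rule′ .positive w = rule .positive (τ w) ∘
    transpose-elim _≟ˢ_ (x ∷ β) (y ∷ β) (λ v w → Positive v → Positive w) (λ _ → py) (λ _ → px) (λ _ p → p) w
  rule′ .rotates w = reach-mono steps (rule .rotates w)

Joins : (Str (3 + k) (suc n) → Str (3 + k) (suc n)) → Str (3 + k) (suc n) × Fin (3 + k) → Set
Joins G (w , y) = Positive w → Positive (y ∷ tail w) → Reach G w (y ∷ tail w)

-- Each join preserves the reachability achieved by the earlier ones, by `reach-mono`, so the order
-- of the pairs is immaterial. `Joins` takes positivity as premises, which allows the list to run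
-- over all pairs.
join-list : (ps : List (Str (3 + k) (suc n) × Fin (3 + k))) → ∃[ G ] SuccessorRule G × All (Joins G) ps
join-list [] = rot , rot-rule , []
join-list ((x ∷ β , y) ∷ ps) with F , rule , joins ← join-list ps
  with positive? (x ∷ β) | positive? (y ∷ β)
... | no ¬p | _     = F , rule , (λ p → contradiction p ¬p) ∷ joins
... | yes _ | no ¬q = F , rule , (λ _ q → contradiction q ¬q) ∷ joins
... | yes p | yes q with G , rule′ , xy , steps ← join-rule rule x y β p q =
  G , rule′ , (λ _ _ → xy) ∷ All.map (λ join p q → reach-mono steps (join p q)) joins

joined-rule : ∀ k n → ∃[ G ] SuccessorRule {k} {n} G × (∀ p → Joins G p)
joined-rule k n with G , rule , joins ← join-list (cartesianProduct (strings (3 + k) (suc n)) (allFin (3 + k))) =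
  G , rule , λ (w , y) → All.lookup joins (∈-cartesianProduct⁺ (∈-strings w) (∈-allFin y))

⟶-reach : {G : Str (3 + k) (suc n) → Str (3 + k) (suc n)} → SuccessorRule G → (∀ p → Joins G p) →
          ∀ {l m} → l ⟶ m → ∀ w → toList w ≡ l → ∃[ v ] toList v ≡ m × Reach G w v
⟶-reach rule joins (rotate₁ x l) (x ∷ β) refl = β ∷ʳ x , toList-∷ʳ x β , rule .rotates (x ∷ β)
⟶-reach rule joins (change x y l px py) (x ∷ β) refl = y ∷ β , refl , joins (x ∷ β , y) px py

⟶*-reach : {G : Str (3 + k) (suc n) → Str (3 + k) (suc n)} → SuccessorRule G → (∀ p → Joins G p) →
           ∀ {l m} → l ⟶* m → ∀ w → toList w ≡ l → ∃[ v ] toList v ≡ m × Reach G w v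
⟶*-reach rule joins stop      w eq = w , eq , reach-refl
⟶*-reach rule joins (s ◅ ss) w eq
  with v , eq₁ , r₁ ← ⟶-reach rule joins s w eq
  with u , eq₂ , r₂ ← ⟶*-reach rule joins ss v eq₁ = u , eq₂ , reach-trans r₁ r₂

-- The common target of the reduction. It contains at least one `2`, since the cyclic word 01 has
-- winding number zero; hence the length is at least 3.
start : ∀ k n → Str (3 + k) (3 + n)
start k n = 𝟘 ∷ 𝟙 ∷ replicate (suc n) 𝟚

start-positive : ∀ k n → Positive (start k n)
start-positive k n = subst (0ℤ ℤ.<_) (sym eq) (ℤ.+<+ (s≤s z≤n))
  where
  eq : winding (start k n) ≡ 1ℤ
  eq = cong (1ℤ +ℤ_) (trans (ℤ.+-identityˡ _)
         (trans (cong (λ l → path 𝟚 (l List.++ List.[ 𝟘 ])) (toList-replicate n 𝟚)) (path-replicate n List.[ 𝟘 ])))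

reach-start : {G : Str (3 + k) (3 + n) → Str (3 + k) (3 + n)} → SuccessorRule G → (∀ p → Joins G p) →
              ∀ w → Positive w → Reach G (start k n) w
reach-start {k} {n} rule joins w pos
  with m , steps ← wind>0⇒⟶* (toList w) pos
  with v , eq , r ← ⟶*-reach rule joins steps w refl
  = reach-sym position position-injective (rule .injective) (subst (Reach _ w) (v≡start m v eq) r)
  where
  -- The list relation forgets lengths; the number of 2s is recovered from the length of `v`.
  v≡start : ∀ m (v : Str (3 + k) (3 + n)) → toList v ≡ 𝟘 ∷ 𝟙 ∷ List.replicate m 𝟚 → v ≡ start k n
  v≡start m v eq with refl ← trans (sym (length-toList v)) (trans (cong length eq) (cong (2 +_) (List.length-replicate m))) =
    trans (sym (cast-is-id refl v)) (toList-injective refl v (start k n)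
      (trans eq (cong (λ l → 𝟘 ∷ 𝟙 ∷ l) (sym (toList-replicate (suc n) 𝟚)))))

-- The cyclic sequence read off an orbit

least : {P : ℕ → Set} → Decidable P → ∀ p → P p → ∃[ q ] P q × (∀ i → i < q → ¬ P i)
least P? zero    Pp = 0 , Pp , λ _ ()
least {P} P? (suc p) Pp with P? 0
... | yes P0 = 0 , P0 , λ _ ()
... | no ¬P0 with q , Pq , minimal ← least (P? ∘ suc) p Pp = suc q , Pq , below
  where
  below : ∀ i → i < suc q → ¬ P i
  below zero    _         = ¬P0
  below (suc i) (s≤s i<q) = minimal i i<q

lookup-∷ʳ-inject₁ : {A : Set} (xs : Vec A n) (z : A) (i : Fin n) → lookup (xs ∷ʳ z) (inject₁ i) ≡ lookup xs i
lookup-∷ʳ-inject₁ (x ∷ xs) z zero    = refl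
lookup-∷ʳ-inject₁ (x ∷ xs) z (suc i) = lookup-∷ʳ-inject₁ xs z i

lookup-injective : {A : Set} {xs : List A} → Unique xs → Injective _≡_ _≡_ (List.lookup xs)
lookup-injective (_ ∷ _)   {zero}  {zero}  _  = refl
lookup-injective (x∉ ∷ _)  {zero}  {suc j} eq = contradiction eq (All.lookup x∉ (∈-lookup j))
lookup-injective (x∉ ∷ _)  {suc i} {zero}  eq = contradiction (sym eq) (All.lookup x∉ (∈-lookup i))
lookup-injective (_ ∷ uxs) {suc i} {suc j} eq = cong suc (lookup-injective uxs eq)

positive-reverse : (w : Str (3 + k) n) → Positive w → ¬ Positive (reverse w)
positive-reverse w pos pos′ = ℤ.<-asym pos (ℤ.neg-cancel-< (subst (0ℤ ℤ.<_) (winding-reverse w) pos′))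

module _ {G : Str (3 + k) (suc n) → Str (3 + k) (suc n)} (rule : SuccessorRule G)
         {p : ℕ} (κ : Str (3 + k) (suc n)) (ret : fold κ G (suc p) ≡ κ) where

  orbit : ℕ → Str (3 + k) (suc n)
  orbit = fold κ G

  orbit-mod : ∀ t → orbit (toℕ (t mod suc p)) ≡ orbit t
  orbit-mod t = begin
    orbit (toℕ (t mod suc p))                       ≡⟨ cong orbit (Fin.toℕ-fromℕ< (m%n<n t (suc p))) ⟩
    orbit (t % suc p)                               ≡⟨ fold-period ret (t / suc p) (t % suc p) ⟨
    orbit (t % suc p + t / suc p * suc p)           ≡⟨ cong orbit (m≡m%n+[m/n]*n t (suc p)) ⟨
    orbit t                                         ∎
    where open ≡-Reasoning

  -- A shift register emits its state symbol by symbol: position `t` moves to the head in `t` steps.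
  -- This is why the heads along an orbit have the states themselves as windows.
  lookup-head : ∀ t w (j : Fin (suc n)) → toℕ j ≡ t → lookup w j ≡ head (fold w G t)
  lookup-head zero    (x ∷ β) zero    refl = refl
  lookup-head (suc t) w@(x ∷ β) (suc j) eq with z , Gw≡ ← rule .shifts w = begin
    lookup β j                       ≡⟨ lookup-∷ʳ-inject₁ β z j ⟨
    lookup (β ∷ʳ z) (inject₁ j)      ≡⟨ cong (λ v → lookup v (inject₁ j)) Gw≡ ⟨
    lookup (G w) (inject₁ j)         ≡⟨ lookup-head t (G w) (inject₁ j) (trans (Fin.toℕ-inject₁ j) (suc-injective eq)) ⟩
    head (fold (G w) G t)            ≡⟨ cong head (fold-+ w G t) ⟨
    head (fold w G (t + 1))          ≡⟨ cong (head ∘ fold w G) (+-comm t 1) ⟩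
    head (fold w G (suc t))          ∎
    where open ≡-Reasoning

  orbit-sequence : Str (3 + k) (suc p)
  orbit-sequence = tabulate (head ∘ orbit ∘ toℕ)

  window-orbit : ∀ t → window (suc n) orbit-sequence t ≡ orbit (toℕ t)
  window-orbit t = trans (tabulate-cong symbol) (tabulate∘lookup (orbit (toℕ t)))
    where
    open ≡-Reasoning
    symbol : ∀ j → lookup orbit-sequence (shift t (toℕ j)) ≡ lookup (orbit (toℕ t)) j
    symbol j = begin
      lookup orbit-sequence (shift t (toℕ j))       ≡⟨ lookup∘tabulate (head ∘ orbit ∘ toℕ) (shift t (toℕ j)) ⟩
      head (orbit (toℕ ((toℕ t + toℕ j) mod suc p))) ≡⟨ cong head (orbit-mod (toℕ t + toℕ j)) ⟩
      head (orbit (toℕ t + toℕ j))                  ≡⟨ cong (head ∘ orbit) (+-comm (toℕ t) (toℕ j)) ⟩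
      head (orbit (toℕ j + toℕ t))                  ≡⟨ cong head (fold-+ κ G (toℕ j)) ⟩
      head (fold (orbit (toℕ t)) G (toℕ j))         ≡⟨ lookup-head (toℕ j) (orbit (toℕ t)) j refl ⟨
      lookup (orbit (toℕ t)) j                      ∎

  orbit-positive : Positive κ → ∀ t → Positive (orbit t)
  orbit-positive pos zero    = pos
  orbit-positive pos (suc t) = rule .positive _ (orbit-positive pos t)

  module _ (minimal : ∀ i → i < p → fold κ G (suc i) ≢ κ) where

    orbit-apart : ∀ {i j} → i < j → j ≤ p → orbit i ≢ orbit j
    orbit-apart {i} i<j j≤p eq with d , sum≡ , ret′ ← fold-cancel (rule .injective) i<j eq =
      minimal d (≤-trans (s≤s (m≤n+m d i)) (≤-trans (≤-reflexive sum≡) j≤p)) ret′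

    orbit-injective : Injective _≡_ _≡_ (orbit ∘ toℕ {suc p})
    orbit-injective {i} {j} eq with <-cmp (toℕ i) (toℕ j)
    ... | tri≈ _ i≡j _ = Fin.toℕ-injective i≡j
    ... | tri< i<j _ _ = contradiction eq (orbit-apart i<j (Fin.toℕ≤pred[n] j))
    ... | tri> _ _ j<i = contradiction (sym eq) (orbit-apart j<i (Fin.toℕ≤pred[n] i))

    window-injective : Injective _≡_ _≡_ (window (suc n) orbit-sequence)
    window-injective {i} {j} eq = orbit-injective (trans (sym (window-orbit i)) (trans eq (window-orbit j)))

    orbit-orientable : Positive κ → Orientable (suc n) orbit-sequence
    orbit-orientable posκ {i} {j} = orientable i j
      where
      positive-window : ∀ t → Positive (window (suc n) orbit-sequence t)
      positive-window t = subst Positive (sym (window-orbit t)) (orbit-positive posκ (toℕ t))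

      windows : Fin (suc p) ⊎ Fin (suc p) → Str (3 + k) (suc n)
      windows = Sum.[ window (suc n) orbit-sequence , reverse ∘ window (suc n) orbit-sequence ]

      orientable : ∀ i j → windows i ≡ windows j → i ≡ j
      orientable (inj₁ i) (inj₁ j) eq = cong inj₁ (window-injective eq)
      orientable (inj₂ i) (inj₂ j) eq = cong inj₂ (window-injective (reverse-injective eq))
      orientable (inj₁ i) (inj₂ j) eq =
        contradiction (subst Positive eq (positive-window i)) (positive-reverse (window (suc n) orbit-sequence j) (positive-window j))
      orientable (inj₂ i) (inj₁ j) eq =
        contradiction (subst Positive (sym eq) (positive-window j)) (positive-reverse (window (suc n) orbit-sequence i) (positive-window i))

  -- Times of visit, taken modulo the period, tell the words apart. For the list of all positive
  -- words this yields the lower bound on `M`.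
  |reachable|≤period : {xs : List (Str (3 + k) (suc n))} → Unique xs → (∀ {w} → w ∈ xs → Reach G κ w) →
                       length xs ≤ suc p
  |reachable|≤period {xs} unique reach = Fin.injective⇒≤ {f = index} index-injective
    where
    time : ∀ i → Reach G κ (List.lookup xs i)
    time i = reach (∈-lookup i)

    index : Fin (length xs) → Fin (suc p)
    index i = proj₁ (time i) mod suc p

    index-injective : Injective _≡_ _≡_ index
    index-injective {i} {j} eq = lookup-injective unique (begin
      List.lookup xs i                ≡⟨ proj₂ (time i) ⟨
      orbit (proj₁ (time i))          ≡⟨ orbit-mod (proj₁ (time i)) ⟨
      orbit (toℕ (index i))           ≡⟨ cong (orbit ∘ toℕ) eq ⟩
      orbit (toℕ (index j))           ≡⟨ orbit-mod (proj₁ (time j)) ⟩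
      orbit (proj₁ (time j))          ≡⟨ proj₂ (time j) ⟩
      List.lookup xs j                ∎)
      where open ≡-Reasoning

period≤M : {G : Str (3 + k) (3 + n) → Str (3 + k) (3 + n)} → SuccessorRule G → (∀ p → Joins G p) →
           ∃[ p ] fold (start k n) G (suc p) ≡ start k n × (∀ i → i < p → fold (start k n) G (suc i) ≢ start k n) →
           length (filter positive? (strings (3 + k) (3 + n))) ≤ M (3 + k) (3 + n)
period≤M {k} {n} rule joins (p , ret , minimal) = ≤-trans
  (|reachable|≤period rule (start k n) ret (Unique.filter⁺ positive? (strings-unique (3 + k) (3 + n)))
    (λ {w} w∈ → reach-start rule joins w (proj₂ (∈-filter⁻ positive? {xs = strings (3 + k) (3 + n)} w∈))))
  (proj₂ (M-isMaxLength (3 + k) (3 + n)) (orbit-sequence rule (start k n) ret)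
    (orbit-orientable rule (start k n) ret minimal (start-positive k n)))

|Positive|≤M : ∀ k n → length (filter positive? (strings (3 + k) (3 + n))) ≤ M (3 + k) (3 + n)
|Positive|≤M k n = from-rule (joined-rule k (2 + n))
  where
  from-rule : ∃[ G ] SuccessorRule {k} {2 + n} G × (∀ p → Joins G p) →
              length (filter positive? (strings (3 + k) (3 + n))) ≤ M (3 + k) (3 + n)
  from-rule (G , rule , joins) = period≤M rule joins
    (uncurry (least (λ i → fold (start k n) G (suc i) ≟ˢ start k n))
      (return-time position position-injective (rule .injective) (start k n)))

-- Asymmetric bracelets

lookup-rot : {A : Set} (w : Vec A n) (i : Fin n) → lookup (rot w) i ≡ lookup w (shift i 1)
lookup-rot {suc n} (x ∷ β) i = go β i
  where
  mod-suc : (i : Fin n) → shift (inject₁ i) 1 ≡ suc i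
  mod-suc i = Fin.toℕ-injective (begin
    toℕ (shift (inject₁ i) 1)          ≡⟨ Fin.toℕ-fromℕ< _ ⟩
    (toℕ (inject₁ i) + 1) % suc n      ≡⟨ cong (_% suc n) (trans (+-comm _ 1) (cong suc (Fin.toℕ-inject₁ i))) ⟩
    suc (toℕ i) % suc n                ≡⟨ m<n⇒m%n≡m (s≤s (Fin.toℕ<n i)) ⟩
    suc (toℕ i)                        ∎)
    where open ≡-Reasoning

  mod-last : shift (fromℕ n) 1 ≡ zero
  mod-last = Fin.toℕ-injective (begin
    toℕ (shift (fromℕ n) 1)        ≡⟨ Fin.toℕ-fromℕ< _ ⟩
    (toℕ (fromℕ n) + 1) % suc n    ≡⟨ cong (_% suc n) (trans (+-comm _ 1) (cong suc (Fin.toℕ-fromℕ n))) ⟩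
    suc n % suc n                                ≡⟨ n%n≡0 (suc n) ⟩
    0                                            ∎)
    where open ≡-Reasoning

  lookup-last : ∀ {m} (γ : Vec _ m) → lookup (γ ∷ʳ x) (fromℕ m) ≡ x
  lookup-last []      = refl
  lookup-last (_ ∷ γ) = lookup-last γ

  go : (β : Vec _ n) (i : Fin (suc n)) → lookup (β ∷ʳ x) i ≡ lookup (x ∷ β) (shift i 1)
  go β i with view i
  ... | ‵fromℕ = trans (lookup-last β) (cong (lookup (x ∷ β)) (sym mod-last))
  ... | ‵inject₁ j =
    trans (lookup-∷ʳ-inject₁ β x j) (cong (lookup (x ∷ β)) (sym (mod-suc j)))

shift-shift : (i : Fin n) (d e : ℕ) → shift (shift i d) e ≡ shift i (d + e)
shift-shift {suc n} i d e = Fin.toℕ-injective (begin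
  toℕ (shift (shift i d) e)                       ≡⟨ Fin.toℕ-fromℕ< _ ⟩
  (toℕ (shift i d) + e) % suc n                   ≡⟨ cong (λ t → (t + e) % suc n) (Fin.toℕ-fromℕ< (m%n<n (toℕ i + d) (suc n))) ⟩
  ((toℕ i + d) % suc n + e) % suc n               ≡⟨ %-distribˡ-+ ((toℕ i + d) % suc n) e (suc n) ⟩
  ((toℕ i + d) % suc n % suc n + e % suc n) % suc n
    ≡⟨ cong (λ t → (t + e % suc n) % suc n) (m%n%n≡m%n (toℕ i + d) (suc n)) ⟩
  ((toℕ i + d) % suc n + e % suc n) % suc n       ≡⟨ %-distribˡ-+ (toℕ i + d) e (suc n) ⟨
  (toℕ i + d + e) % suc n                         ≡⟨ cong (_% suc n) (+-assoc (toℕ i) d e) ⟩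
  (toℕ i + (d + e)) % suc n                       ≡⟨ Fin.toℕ-fromℕ< _ ⟨
  toℕ (shift i (d + e))                           ∎)
  where open ≡-Reasoning

shift-0 : (i : Fin n) → shift i 0 ≡ i
shift-0 {suc n} i = Fin.toℕ-injective (trans (Fin.toℕ-fromℕ< _)
  (trans (cong (_% suc n) (+-identityʳ (toℕ i))) (m<n⇒m%n≡m (Fin.toℕ<n i))))

rotate≡fold-rot : ∀ d (w : Str k n) → rotate d w ≡ fold w rot d
rotate≡fold-rot zero    w = trans (tabulate-cong (cong (lookup w) ∘ shift-0)) (tabulate∘lookup w)
rotate≡fold-rot (suc d) w = trans (tabulate-cong symbol) (trans (tabulate∘lookup (rot (rotate d w))) (cong rot (rotate≡fold-rot d w)))
  where
  open ≡-Reasoning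
  symbol : ∀ i → lookup w (shift i (suc d)) ≡ lookup (rot (rotate d w)) i
  symbol i = begin
    lookup w (shift i (suc d))            ≡⟨ cong (lookup w) (shift-shift i 1 d) ⟨
    lookup w (shift (shift i 1) d)        ≡⟨ lookup∘tabulate _ (shift i 1) ⟨
    lookup (rotate d w) (shift i 1)       ≡⟨ lookup-rot (rotate d w) i ⟨
    lookup (rot (rotate d w)) i           ∎

-- Seeing rotation classes as orbits of the injection `rot` gives symmetry for free from
-- `reach-sym`.
_≈_ : Str k n → Str k n → Set
_≈_ = Reach rot

∈[]⇒≈ : {α β : Str k n} → β ∈[ α ] → α ≈ β
∈[]⇒≈ {α = α} (d , eq) = d , sym (trans eq (rotate≡fold-rot d α))

≈⇒∈[] : {α β : Str k n} → α ≈ β → β ∈[ α ]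
≈⇒∈[] {α = α} (d , eq) = d , sym (trans (rotate≡fold-rot d α) eq)

≈-sym : {α β : Str k n} → α ≈ β → β ≈ α
≈-sym = reach-sym position position-injective rot-injective

-- Reversal conjugates `rot` to its inverse; stated without the inverse.
reverse-rot : (w : Str k n) → rot (reverse (rot w)) ≡ reverse w
reverse-rot []      = refl
reverse-rot (x ∷ β) = trans (cong (rot ∘ reverse) (trans (cong (_∷ʳ x) (sym (reverse-involutive β))) (sym (reverse-∷ x (reverse β)))))
  (trans (cong rot (reverse-involutive (x ∷ reverse β))) (sym (reverse-∷ x β)))

≈-reverse : {α β : Str k n} → α ≈ β → reverse α ≈ reverse β
≈-reverse (zero  , refl) = reach-refl
≈-reverse {α = α} (suc t , refl) = reach-trans (≈-reverse (t , refl)) (≈-sym (1 , reverse-rot (fold α rot t)))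

≈-reverse⁻ : {α β : Str k n} → reverse α ≈ β → α ≈ reverse β
≈-reverse⁻ {α = α} r = subst (_≈ _) (reverse-involutive α) (≈-reverse r)

≈-winding : {α β : Str (3 + k) n} → α ≈ β → winding α ≡ winding β
≈-winding (zero  , refl) = refl
≈-winding {α = α} (suc t , refl) = trans (≈-winding (t , refl)) (sym (winding-rot (fold α rot t)))

≤ˡᵉˣ-isTotalOrder : IsTotalOrder _ (_≤ˡᵉˣ_ {k} {n})
≤ˡᵉˣ-isTotalOrder = Lex.≤-isTotalOrder Fin.<-isStrictTotalOrder

-- The bracelets `α` of `w` and `β` of `reverse w` are minimal in the same class under rotation and
-- reversal, so they coincide. Then `reverse α` is a rotation of `α`, against asymmetry.
InS-reverse : {w : Str k n} → InS w → ¬ InS (reverse w)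
InS-reverse {w = w} (α , (α-min , α-asym) , w∈α) (β , (β-min , _) , w′∈β) =
  α-asym (≈⇒∈[] (≈-sym (subst (reverse α ≈_) (sym α≡β) α′≈β)))
  where
  module ≤ = IsTotalOrder ≤ˡᵉˣ-isTotalOrder

  α′≈β : reverse α ≈ β
  α′≈β = reach-trans (≈-reverse {α = α} (∈[]⇒≈ w∈α)) (≈-sym (∈[]⇒≈ w′∈β))

  α≡β : α ≡ β
  α≡β = Pointwise-≡⇒≡ (≤.antisym (α-min β (inj₂ (≈⇒∈[] α′≈β))) (β-min α (inj₂ (≈⇒∈[] (≈-sym (≈-reverse⁻ α′≈β))))))

minimum : {P : Str k n → Set} → Decidable P → ∀ {w} → P w → ∃[ α ] P α × (∀ β → P β → α ≤ˡᵉˣ β)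
minimum {k} {n} {P} P? {w} Pw =
  let α , Pα , _ , α-min = go (strings k n) in α , Pα , λ β → All.lookup α-min (∈-strings β)
  where
  module ≤ = IsTotalOrder (≤ˡᵉˣ-isTotalOrder {k} {n})

  go : ∀ xs → ∃[ α ] P α × α ≤ˡᵉˣ w × All (λ β → P β → α ≤ˡᵉˣ β) xs
  go [] = w , Pw , ≤.refl , []
  go (x ∷ xs) with α , Pα , α≤w , α-min ← go xs with P? x
  ... | no ¬Px = α , Pα , α≤w , (λ Px → contradiction Px ¬Px) ∷ α-min
  ... | yes Px with ≤.total α x
  ...   | inj₁ α≤x = α , Pα , α≤w , (λ _ → α≤x) ∷ α-min
  ...   | inj₂ x≤α = x , Px , ≤.trans x≤α α≤w , (λ _ → ≤.refl) ∷ All.map (λ α≤ Pβ → ≤.trans x≤α (α≤ Pβ)) α-min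

neg-fixed : ∀ {i} → ℤ.- i ≡ i → i ≡ 0ℤ
neg-fixed {ℤ.+ zero} _ = refl

winding≢0⇒asymmetric : {α : Str (3 + k) n} → winding α ≢ 0ℤ → ¬ Symmetric α
winding≢0⇒asymmetric {α = α} ≢0 sym-α =
  ≢0 (neg-fixed (trans (sym (winding-reverse α)) (sym (≈-winding {α = α} (∈[]⇒≈ sym-α)))))

-- The least word among the rotations of `w` and `reverse w` is a bracelet, and its winding number
-- is that of `w` up to sign, hence nonzero. The two cases record on which side the least word lies.
winding≢0⇒InS : (w : Str (3 + k) n) → winding w ≢ 0ℤ → InS w ⊎ InS (reverse w)
winding≢0⇒InS w ≢0 with minimum (λ β → (β ∈[ w ]?) ⊎-dec (β ∈[ reverse w ]?)) (inj₁ (≈⇒∈[] (reach-refl {a = w})))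
... | α , inj₁ α∈w , α-min = inj₁ (α , (bracelet , winding≢0⇒asymmetric {α = α} α≢0) , ≈⇒∈[] (≈-sym w≈α))
  where
  w≈α = ∈[]⇒≈ α∈w
  α≢0 = λ eq → ≢0 (trans (≈-winding w≈α) eq)
  bracelet : Bracelet α
  bracelet β (inj₁ β∈) = α-min β (inj₁ (≈⇒∈[] (reach-trans w≈α (∈[]⇒≈ β∈))))
  bracelet β (inj₂ β∈) = α-min β (inj₂ (≈⇒∈[] (reach-trans (≈-reverse w≈α) (∈[]⇒≈ β∈))))
... | α , inj₂ α∈w′ , α-min = inj₂ (α , (bracelet , winding≢0⇒asymmetric {α = α} α≢0) , ≈⇒∈[] (≈-sym w′≈α))
  where
  w′≈α = ∈[]⇒≈ α∈w′
  α≢0 = λ eq → ≢0 (ℤ.neg-injective (trans (sym (winding-reverse w)) (trans (≈-winding w′≈α) eq)))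
  bracelet : Bracelet α
  bracelet β (inj₁ β∈) = α-min β (inj₂ (≈⇒∈[] (reach-trans w′≈α (∈[]⇒≈ β∈))))
  bracelet β (inj₂ β∈) = α-min β (inj₁ (≈⇒∈[] (reach-trans (≈-reverse⁻ {α = w} w′≈α) (∈[]⇒≈ β∈))))

-- Counting words and their reversals

module _ {A : Set} {P Q : A → Set} (P? : Decidable P) (Q? : Decidable Q) where

  length-filter-disjoint : (∀ x → P x → ¬ Q x) → ∀ xs → length (filter P? xs) + length (filter Q? xs) ≤ length xs
  length-filter-disjoint disjoint [] = z≤n
  length-filter-disjoint disjoint (x ∷ xs) with P? x | Q? x | length-filter-disjoint disjoint xs
  ... | yes p | yes q | _  = contradiction q (disjoint x p)
  ... | yes _ | no _  | ih = s≤s ih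
  ... | no _  | yes _ | ih = ≤-trans (≤-reflexive (+-suc _ _)) (s≤s ih)
  ... | no _  | no _  | ih = m≤n⇒m≤1+n ih

  length-filter-cover : {R : A → Set} (R? : Decidable R) → (∀ x → ¬ R x → P x ⊎ Q x) → ∀ xs →
                        length xs ≤ length (filter P? xs) + length (filter Q? xs) + length (filter R? xs)
  length-filter-cover R? cover [] = z≤n
  length-filter-cover R? cover (x ∷ xs) with ih ← length-filter-cover R? cover xs with R? x
  ... | yes _ = ≤-trans (s≤s ih) (≤-trans (≤-reflexive (sym (+-suc _ _))) (+-monoˡ-≤ _ (+-mono-≤ (filter-∷ P?) (filter-∷ Q?))))
    where
    filter-∷ : ∀ {S : A → Set} (S? : Decidable S) → length (filter S? xs) ≤ length (filter S? (x ∷ xs))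
    filter-∷ S? with S? x
    ... | yes _ = n≤1+n _
    ... | no _  = ≤-refl
  ... | no ¬r with P? x | Q? x
  ...   | yes _ | yes _ = s≤s (≤-trans ih (+-monoˡ-≤ _ (+-monoʳ-≤ (length (filter P? xs)) (n≤1+n _))))
  ...   | yes _ | no _  = s≤s ih
  ...   | no _  | yes _ = ≤-trans (s≤s ih) (≤-reflexive (cong (_+ length (filter R? xs)) (sym (+-suc _ _))))
  ...   | no ¬p | no ¬q = contradiction (cover x ¬r) Sum.[ ¬p , ¬q ]

length-injection : {A B : Set} {xs : List A} {ys : List B} {f : A → B} → Unique xs → Injective _≡_ _≡_ f →
                   (∀ {x} → x ∈ xs → f x ∈ ys) → length xs ≤ length ys
length-injection {xs = xs} {ys} {f} unique inj into = Fin.injective⇒≤ {f = index} λ {i} {j} eq →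
  lookup-injective unique (inj (trans (lookup-index (into (∈-lookup i)))
    (trans (cong (List.lookup ys) eq) (sym (lookup-index (into (∈-lookup j)))))))
  where
  index : Fin (length xs) → Fin (length ys)
  index i = Any.index (into (∈-lookup i))

module _ {P : Str k n → Set} (P? : Decidable P) where

  length-filter-reverse : length (filter P? (strings k n)) ≤ length (filter (P? ∘ reverse) (strings k n))
  length-filter-reverse = length-injection (Unique.filter⁺ P? (strings-unique k n)) reverse-injective λ {w} w∈ →
    ∈-filter⁺ (P? ∘ reverse) (∈-strings (reverse w))
      (subst P (sym (reverse-involutive w)) (proj₂ (∈-filter⁻ P? {xs = strings k n} w∈)))

  length-filter-reverse⁻ : length (filter (P? ∘ reverse) (strings k n)) ≤ length (filter P? (strings k n))
  length-filter-reverse⁻ = length-injection (Unique.filter⁺ (P? ∘ reverse) (strings-unique k n)) reverse-injective λ {w} w∈ →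
    ∈-filter⁺ P? (∈-strings (reverse w)) (proj₂ (∈-filter⁻ (P? ∘ reverse) {xs = strings k n} w∈))

2L≤|strings| : ∀ k n → L k n + L k n ≤ length (strings k n)
2L≤|strings| k n = ≤-trans (+-monoʳ-≤ (L k n) (length-filter-reverse (inS? {k} {n})))
  (length-filter-disjoint inS? (inS? ∘ reverse) (λ w → InS-reverse {w = w}) (strings k n))

2M≤|strings| : ∀ k n → M k n + M k n ≤ length (strings k n)
2M≤|strings| k n = bound (proj₁ (M-isMaxLength k n))
  where
  bound : ∀ {m} → Σ[ s ∈ Str k m ] Orientable n s → m + m ≤ length (strings k n)
  bound {m} (s , orientable) = Fin.injective⇒≤ {f = index} λ {i} {j} eq →
    trans (sym (Fin.join-splitAt m m i))
      (trans (cong (join m m) (orientable {splitAt m i} {splitAt m j} (position-injective eq))) (Fin.join-splitAt m m j))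
    where
    index : Fin (m + m) → Fin (length (strings k n))
    index = position {k} {n} ∘ Sum.[ window n s , reverse ∘ window n s ] ∘ splitAt m

balanced? : Decidable (λ (w : Str (3 + k) n) → winding w ≡ 0ℤ)
balanced? w = winding w ℤ.≟ 0ℤ

Z : ℕ → ℕ → ℕ
Z k n = length (filter (balanced? {k} {n}) (strings (3 + k) n))

|strings|≤2L+Z : ∀ k n → length (strings (3 + k) n) ≤ L (3 + k) n + L (3 + k) n + Z k n
|strings|≤2L+Z k n = ≤-trans
  (length-filter-cover inS? (inS? ∘ reverse) balanced? winding≢0⇒InS (strings (3 + k) n))
  (+-monoˡ-≤ (Z k n) (+-monoʳ-≤ (L (3 + k) n) (length-filter-reverse⁻ (inS? {3 + k} {n}))))

positive-or-reverse : (w : Str (3 + k) n) → winding w ≢ 0ℤ → Positive w ⊎ Positive (reverse w)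
positive-or-reverse w ≢0 with ℤ.<-cmp 0ℤ (winding w)
... | tri< pos _ _ = inj₁ pos
... | tri≈ _ eq _  = contradiction (sym eq) ≢0
... | tri> _ _ neg = inj₂ (subst (0ℤ ℤ.<_) (sym (winding-reverse w)) (ℤ.neg-mono-< neg))

|strings|≤2M+Z : ∀ k n → length (strings (3 + k) (3 + n)) ≤ M (3 + k) (3 + n) + M (3 + k) (3 + n) + Z k (3 + n)
|strings|≤2M+Z k n = ≤-trans
  (length-filter-cover positive? (positive? ∘ reverse) balanced? positive-or-reverse (strings (3 + k) (3 + n)))
  (+-monoˡ-≤ (Z k (3 + n)) (+-mono-≤ (|Positive|≤M k n)
    (≤-trans (length-filter-reverse⁻ {3 + k} {3 + n} positive?) (|Positive|≤M k n))))

-- Anticoncentration of the winding number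

∑ : ∀ {n} → (Fin n → ℕ) → ℕ
∑ = sum +-*-semiring

∑-bound : ∀ {V} (f : Fin n → ℕ) → (∀ i → f i ≤ V) → ∑ f ≤ n * V
∑-bound {zero}  f f≤V = z≤n
∑-bound {suc n} f f≤V = +-mono-≤ (f≤V zero) (∑-bound (f ∘ suc) (f≤V ∘ suc))

-- One term is kept exactly and the other `n - 1` are bounded by `V`; the `V` on the left replaces a
-- subtraction on the right.
∑-isolate : ∀ {V} (f : Fin n → ℕ) → (∀ i → f i ≤ V) → ∀ y → ∑ f + V ≤ f y + n * V
∑-isolate {suc n} {V} f f≤V zero = ≤-trans (≤-reflexive (+-assoc (f zero) _ V))
  (+-monoʳ-≤ (f zero) (≤-trans (+-monoˡ-≤ V (∑-bound (f ∘ suc) (f≤V ∘ suc))) (≤-reflexive (+-comm _ V))))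
∑-isolate {suc n} {V} f f≤V (suc y) = begin
  f zero + ∑ (f ∘ suc) + V         ≡⟨ +-assoc (f zero) _ V ⟩
  f zero + (∑ (f ∘ suc) + V)       ≤⟨ +-mono-≤ (f≤V zero) (∑-isolate (f ∘ suc) (f≤V ∘ suc) y) ⟩
  V + (f (suc y) + n * V)          ≡⟨ solve 3 (λ V f nV → V :+ (f :+ nV) := f :+ (V :+ nV)) refl V (f (suc y)) (n * V) ⟩
  f (suc y) + (V + n * V)          ∎
  where
  open ≤-Reasoning
  open +-*-Solver

-- Transitivity for differences: `x + b ≤ y + c` reads `x - c ≤ y - b`, and `y + a ≤ z + b` reads
-- `y - b ≤ z - a`.
telescope : ∀ {x y z a b c} → x + b ≤ y + c → y + a ≤ z + b → x + a ≤ z + c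
telescope {x} {y} {z} {a} {b} {c} h₁ h₂ = +-cancelʳ-≤ (y + b) (x + a) (z + c) (begin
  x + a + (y + b)      ≡⟨ solve 4 (λ x a y b → x :+ a :+ (y :+ b) := (x :+ b) :+ (y :+ a)) refl x a y b ⟩
  (x + b) + (y + a)    ≤⟨ +-mono-≤ h₁ h₂ ⟩
  (y + c) + (z + b)    ≡⟨ solve 4 (λ y c z b → y :+ c :+ (z :+ b) := (z :+ c) :+ (y :+ b)) refl y c z b ⟩
  z + c + (y + b)      ∎)
  where
  open ≤-Reasoning
  open +-*-Solver

window-sum : (ℤ → ℕ) → ℕ → ℤ → ℕ
window-sum f zero    a = 0
window-sum f (suc r) a = f a + window-sum f r (1ℤ +ℤ a)

window-sum-∑ : (f : Fin n → ℤ → ℕ) → ∀ r a → window-sum (λ a → ∑ (λ y → f y a)) r a ≡ ∑ (λ y → window-sum (f y) r a)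
window-sum-∑ {zero}  f zero    a = refl
window-sum-∑ {suc n} f zero    a = window-sum-∑ (f ∘ suc) 0 a
window-sum-∑ f (suc r) a = trans (cong (∑ (λ y → f y a) +_) (window-sum-∑ f r (1ℤ +ℤ a)))
  (sym (∑-distrib-+ +-*-semiring (λ y → f y a) (λ y → window-sum (f y) r (1ℤ +ℤ a))))

window-sum-shift : ∀ (f : ℤ → ℕ) c r a → window-sum (λ a → f (a +ℤ c)) r a ≡ window-sum f r (a +ℤ c)
window-sum-shift f c zero    a = refl
window-sum-shift f c (suc r) a = cong (f (a +ℤ c) +_)
  (trans (window-sum-shift f c r (1ℤ +ℤ a)) (cong (window-sum f r) (ℤ.+-assoc 1ℤ a c)))

indicator : ℕ → ℤ → ℕ
indicator R a = if does (a ℤ.≟ 0ℤ) then R else 0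

window-sum-indicator-pos : ∀ R r m → window-sum (indicator R) r (ℤ.+ suc m) ≡ 0
window-sum-indicator-pos R zero    m = refl
window-sum-indicator-pos R (suc r) m = window-sum-indicator-pos R r (suc m)

window-sum-indicator : ∀ R r a → window-sum (indicator R) r a ≤ R
window-sum-indicator R zero    a = z≤n
window-sum-indicator R (suc r) (ℤ.+ zero)  = ≤-reflexive (trans (cong (R +_) (window-sum-indicator-pos R r 0)) (+-identityʳ R))
window-sum-indicator R (suc r) (ℤ.+ suc m) = window-sum-indicator R r (ℤ.+ suc (suc m))
window-sum-indicator R (suc r) ℤ.-[1+ m ]  = window-sum-indicator R r (1ℤ +ℤ ℤ.-[1+ m ])

-- zeros x₀ R n p a is R times the number of words w of length n for which
-- the path p w x₀ has total crossing number - a.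
zeros : Fin (3 + k) → ℕ → ℕ → Fin (3 + k) → ℤ → ℕ
zeros x₀ R zero    p a = indicator R (a +ℤ cross p x₀)
zeros x₀ R (suc n) p a = ∑ (λ y → zeros x₀ R n y (a +ℤ cross p y))

module _ {k} (x₀ : Fin (3 + k)) (R : ℕ) where

  private
    K = 3 + k
    z = zeros x₀ R

  -- A word has a single crossing number, so it is counted for at most one of the `r` consecutive
  -- offsets. Thus `r` terms together obey the trivial bound for one term, which is the source of
  -- the anticoncentration.
  window-sum-zeros : ∀ n p r a → window-sum (z n p) r a ≤ K ^ n * R
  window-sum-zeros zero p r a = ≤-trans (≤-reflexive (window-sum-shift (indicator R) (cross p x₀) r a))
    (≤-trans (window-sum-indicator R r (a +ℤ cross p x₀)) (≤-reflexive (sym (+-identityʳ R))))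
  window-sum-zeros (suc n) p r a = begin
    window-sum (z (suc n) p) r a                                        ≡⟨ window-sum-∑ (λ y a → z n y (a +ℤ cross p y)) r a ⟩
    ∑ (λ y → window-sum (λ a → z n y (a +ℤ cross p y)) r a)
      ≤⟨ ∑-bound _ (λ y → ≤-trans (≤-reflexive (window-sum-shift (z n y) (cross p y) r a)) (window-sum-zeros n y r (a +ℤ cross p y))) ⟩
    K * (K ^ n * R)                                                     ≡⟨ *-assoc K (K ^ n) R ⟨
    K ^ suc n * R                                                       ∎
    where open ≤-Reasoning

  zeros-≤ : ∀ n p a → z n p a ≤ K ^ n * R
  zeros-≤ n p a = ≤-trans (≤-reflexive (sym (+-identityʳ _))) (window-sum-zeros n p 1 a)

  module _ {N W : ℕ} (z≤W : ∀ p a → z N p a ≤ W) where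

    private
      V : ℕ → ℕ
      V m = K ^ m * W

      V-suc : ∀ m → V (suc m) ≡ K * V m
      V-suc m = *-assoc K (K ^ m) W

    zeros-≤-V : ∀ m p a → z (m + N) p a ≤ V m
    zeros-≤-V zero    p a = ≤-trans (z≤W p a) (≤-reflexive (sym (+-identityʳ W)))
    zeros-≤-V (suc m) p a = ≤-trans (∑-bound _ (λ y → zeros-≤-V m y (a +ℤ cross p y))) (≤-reflexive (sym (V-suc m)))

    zeros-isolate : ∀ m p y a → z (suc m + N) p a + V m ≤ z (m + N) y (a +ℤ cross p y) + V (suc m)
    zeros-isolate m p y a = ≤-trans (∑-isolate _ (λ y → zeros-≤-V m y (a +ℤ cross p y)) y)
      (≤-reflexive (cong (z (m + N) y (a +ℤ cross p y) +_) (sym (V-suc m))))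

    zeros-isolate-2 : ∀ m p a → z (suc m + N) p a + V m ≤ z (m + N) 𝟚 a + V (suc m)
    zeros-isolate-2 m p a = ≤-trans (zeros-isolate m p 𝟚 a) (≤-reflexive
      (cong (λ b → z (m + N) 𝟚 b + V (suc m)) (trans (cong (a +ℤ_) (cross-suc²ʳ p zero)) (ℤ.+-identityʳ a))))

    zeros-isolate-0-2 : ∀ m a → z (suc m + N) 𝟚 a + (V m + V m) ≤ z (m + N) 𝟘 a + z (m + N) 𝟚 a + V (suc m)
    zeros-isolate-0-2 m a = begin
      f 𝟘 + ∑ (f ∘ suc) + (V m + V m)          ≡⟨ solve 3 (λ f s v → f :+ s :+ (v :+ v) := f :+ (s :+ v) :+ v) refl (f 𝟘) (∑ (f ∘ suc)) (V m) ⟩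
      f 𝟘 + (∑ (f ∘ suc) + V m) + V m          ≤⟨ +-monoˡ-≤ (V m) (+-monoʳ-≤ (f 𝟘) (∑-isolate (f ∘ suc) (λ y → zeros-≤-V m (suc y) _) (suc zero))) ⟩
      f 𝟘 + (f 𝟚 + (2 + k) * V m) + V m        ≡⟨ solve 4 (λ f g v w → f :+ (g :+ w) :+ v := f :+ g :+ (v :+ w)) refl (f 𝟘) (f 𝟚) (V m) ((2 + k) * V m) ⟩
      f 𝟘 + f 𝟚 + K * V m                      ≡⟨ cong₂ (λ b c → z (m + N) 𝟘 b + z (m + N) 𝟚 b + c) (ℤ.+-identityʳ a) (sym (V-suc m)) ⟩
      z (m + N) 𝟘 a + z (m + N) 𝟚 a + V (suc m) ∎
      where
      open ≤-Reasoning
      open +-*-Solver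
      f : Fin K → ℕ
      f y = z (m + N) y (a +ℤ cross 𝟚 y)

    zeros-222 : ∀ m a → z (m + N) 𝟚 a + W ≤ z N 𝟚 a + V m
    zeros-222 zero    a = +-monoʳ-≤ (z N 𝟚 a) (≤-reflexive (sym (+-identityʳ W)))
    zeros-222 (suc m) a = telescope {x = z (suc m + N) 𝟚 a} {y = z (m + N) 𝟚 a} (zeros-isolate-2 m 𝟚 a) (zeros-222 m a)

    -- The blocks (012)^i 2^(3r-3i) with i < r have crossing numbers i and
    -- all lead from 2 to 2.
    zeros-blocks : ∀ r a → z (r * 3 + N) 𝟚 a + r * W ≤ window-sum (z N 𝟚) r a + V (r * 3)
    zeros-blocks zero    a = ≤-trans (≤-reflexive (+-identityʳ _)) (zeros-≤-V 0 𝟚 a)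
    zeros-blocks (suc r) a = combine
      {z (3 + m + N) 𝟚 a} {z (2 + m + N) 𝟘 a} {z (2 + m + N) 𝟚 a} {window-sum (z N 𝟚) r (1ℤ +ℤ a)} {z N 𝟚 a}
      (zeros-isolate-0-2 (2 + m) a)
      (telescope {z (2 + m + N) 𝟘 a} {z (1 + m + N) 𝟙 (1ℤ +ℤ a)} {b = V (1 + m)}
        (≤-trans (zeros-isolate (1 + m) 𝟘 𝟙 a)
          (≤-reflexive (cong (λ b → z (1 + m + N) 𝟙 b + V (2 + m)) (ℤ.+-comm a 1ℤ))))
        (telescope {z (1 + m + N) 𝟙 (1ℤ +ℤ a)} {z (m + N) 𝟚 (1ℤ +ℤ a)} {b = V m}
          (zeros-isolate-2 m 𝟙 (1ℤ +ℤ a)) (zeros-blocks r (1ℤ +ℤ a))))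
      (zeros-222 (2 + m) a)
      where
      m = r * 3
      open ≤-Reasoning
      open +-*-Solver
      -- In differences: `X - w ≤ (x - v) + (y - v)`, where `x - v ≤ s - rW` comes from the blocks
      -- that start with 012 and `y - v ≤ t - u` from the block of 2s only.
      combine : ∀ {X x y s t v w u rW} → X + (v + v) ≤ x + y + w → x + rW ≤ s + v → y + u ≤ t + v → X + (u + rW) ≤ t + s + w
      combine {X} {x} {y} {s} {t} {v} {w} {u} {rW} h₁ h₂ h₃ = +-cancelʳ-≤ (v + v + x + y) _ _ (begin
        X + (u + rW) + (v + v + x + y)
          ≡⟨ solve 6 (λ X u r v x y → X :+ (u :+ r) :+ (v :+ v :+ x :+ y) := (X :+ (v :+ v)) :+ ((x :+ r) :+ (y :+ u))) refl X u rW v x y ⟩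
        (X + (v + v)) + ((x + rW) + (y + u))       ≤⟨ +-mono-≤ h₁ (+-mono-≤ h₂ h₃) ⟩
        (x + y + w) + ((s + v) + (t + v))
          ≡⟨ solve 6 (λ x y w s v t → (x :+ y :+ w) :+ ((s :+ v) :+ (t :+ v)) := t :+ s :+ w :+ (v :+ v :+ x :+ y)) refl x y w s v t ⟩
        t + s + w + (v + v + x + y)                ∎)

    -- A leading `2` makes the state independent of `p`, whence the segment length `3r + 1`. Of all
    -- segments, `r` contribute jointly at most `K ^ N * R`; each of the others contributes at most
    -- `W`.
    zeros-step : ∀ r p a → z (suc (r * 3) + N) p a + r * W ≤ K ^ N * R + V (suc (r * 3))
    zeros-step r p a = ≤-trans
      (telescope {x = z (suc (r * 3) + N) p a} {y = z (r * 3 + N) 𝟚 a} (zeros-isolate-2 (r * 3) p a) (zeros-blocks r a))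
      (+-monoˡ-≤ (V (suc (r * 3))) (window-sum-zeros N 𝟚 r a))

-- Iterating over many segments

n≤K^n : ∀ k n → n ≤ (3 + k) ^ n
n≤K^n k zero    = z≤n
n≤K^n k (suc n) = begin
  1 + n                              ≤⟨ +-mono-≤ (m^n>0 (3 + k) n) (n≤K^n k n) ⟩
  (3 + k) ^ n + (3 + k) ^ n          ≤⟨ +-monoʳ-≤ ((3 + k) ^ n) (m≤m+n _ _) ⟩
  (3 + k) ^ suc n                    ∎
  where open ≤-Reasoning

-- Bernoulli's inequality `(1 + 1/d)^q ≥ 1 + q/d`, multiplied by `d^(q+1)`.
bernoulli : ∀ d q → (d + q) * d ^ q ≤ d * suc d ^ q
bernoulli d zero    = ≤-reflexive (cong (_* 1) (+-identityʳ d))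
bernoulli d (suc q) = begin
  (d + suc q) * (d * d ^ q)              ≤⟨ m≤m+n _ (q * d ^ q) ⟩
  (d + suc q) * (d * d ^ q) + q * d ^ q
    ≡⟨ solve 3 (λ d q e → (d :+ (con 1 :+ q)) :* (d :* e) :+ q :* e := (d :* d :+ q :* d :+ (d :+ q)) :* e) refl d q (d ^ q) ⟩
  (d * d + q * d + (d + q)) * d ^ q
    ≡⟨ solve 3 (λ d q e → (d :* d :+ q :* d :+ (d :+ q)) :* e := (con 1 :+ d) :* ((d :+ q) :* e)) refl d q (d ^ q) ⟩
  suc d * ((d + q) * d ^ q)              ≤⟨ *-monoʳ-≤ (suc d) (bernoulli d q) ⟩
  suc d * (d * suc d ^ q)                ≡⟨ solve 2 (λ d e → (con 1 :+ d) :* (d :* e) := d :* ((con 1 :+ d) :* e)) refl d (suc d ^ q) ⟩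
  d * (suc d * suc d ^ q)                ∎
  where
  open ≤-Reasoning
  open +-*-Solver

r*d^q≤[1+d]^q : ∀ r d q → r * d < q → r * d ^ q ≤ suc d ^ q
r*d^q≤[1+d]^q r zero    (suc q) _    = ≤-trans (≤-reflexive (*-zeroʳ r)) z≤n
r*d^q≤[1+d]^q r d@(suc _) q rd<q = *-cancelˡ-≤ d (begin
  d * (r * d ^ q)            ≡⟨ solve 3 (λ d r e → d :* (r :* e) := r :* d :* e) refl d r (d ^ q) ⟩
  r * d * d ^ q              ≤⟨ *-monoˡ-≤ (d ^ q) (≤-trans (<⇒≤ rd<q) (m≤n+m q d)) ⟩
  (d + q) * d ^ q            ≤⟨ bernoulli d q ⟩
  d * suc d ^ q              ∎)
  where
  open ≤-Reasoning
  open +-*-Solver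

-- `D ^ q * K ^ s` is the number of words none of whose `q` aligned segments is one of the `r`
-- special ones; these carry the full weight `r`. With weight `R = r` the term `K ^ N` reproduces
-- itself under `zeros-step`, because `r + D = K ^ B`, while the second term is multiplied by `D`
-- only.
zeros-≤-mixed : ∀ (x₀ : Fin (3 + k)) r D → (3 + k) ^ suc (r * 3) ≡ r + D → ∀ q s p a →
                zeros x₀ r (q * suc (r * 3) + s) p a ≤ (3 + k) ^ (q * suc (r * 3) + s) + r * D ^ q * (3 + k) ^ s
zeros-≤-mixed {k} x₀ r D K^B≡ zero s p a = ≤-trans (zeros-≤ x₀ r s p a)
  (≤-trans (≤-reflexive (trans (*-comm ((3 + k) ^ s) r) (cong (_* (3 + k) ^ s) (sym (*-identityʳ r))))) (m≤n+m _ _))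
zeros-≤-mixed {k} x₀ r D K^B≡ (suc q) s p a = subst (λ m → zeros x₀ r m p a ≤ K ^ m + r * D ^ suc q * K ^ s)
  (sym (+-assoc B (q * B) s)) (+-cancelʳ-≤ (r * W) _ _ (begin
    zeros x₀ r (B + N) p a + r * W             ≤⟨ zeros-step x₀ r {N} {W} (zeros-≤-mixed x₀ r D K^B≡ q s) r p a ⟩
    K ^ N * r + K ^ B * W                      ≡⟨ cong (λ c → K ^ N * r + c * W) K^B≡ ⟩
    K ^ N * r + (r + D) * W
      ≡⟨ solve 5 (λ c r D d s → c :* r :+ (r :+ D) :* (c :+ r :* d :* s) := (r :+ D) :* c :+ r :* (D :* d) :* s :+ r :* (c :+ r :* d :* s)) refl (K ^ N) r D (D ^ q) (K ^ s) ⟩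
    (r + D) * K ^ N + r * D ^ suc q * K ^ s + r * W   ≡⟨ cong (λ c → c * K ^ N + r * D ^ suc q * K ^ s + r * W) K^B≡ ⟨
    K ^ B * K ^ N + r * D ^ suc q * K ^ s + r * W     ≡⟨ cong (λ c → c + r * D ^ suc q * K ^ s + r * W) (^-distribˡ-+-* K B N) ⟨
    K ^ (B + N) + r * D ^ suc q * K ^ s + r * W       ∎))
  where
  open ≤-Reasoning
  open +-*-Solver
  K = 3 + k
  B = suc (r * 3)
  N = q * B + s
  W = K ^ N + r * D ^ q * K ^ s

zeros-anticoncentrated : ∀ k r → 0 < r → ∃[ N ] ∀ n → N ≤ n → ∀ (x₀ p : Fin (3 + k)) a → zeros x₀ r n p a ≤ 2 * (3 + k) ^ n
-- From this length on there are more than `r * D` segments, so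
-- `r * D ^ q ≤ suc D ^ q ≤ (K ^ B) ^ q` and both terms of `zeros-≤-mixed` are at most `K ^ n`.
zeros-anticoncentrated k r 0<r = suc (r * D) * B , bound
  where
  K = 3 + k
  B = suc (r * 3)
  D = K ^ B ∸ r

  r≤K^B : r ≤ K ^ B
  r≤K^B = ≤-trans (n≤K^n k r) (^-monoʳ-≤ K (m≤n⇒m≤1+n (m≤m*n r 3)))

  K^B≡ : K ^ B ≡ r + D
  K^B≡ = sym (m+[n∸m]≡n r≤K^B)

  bound : ∀ n → suc (r * D) * B ≤ n → ∀ x₀ p a → zeros x₀ r n p a ≤ 2 * K ^ n
  bound n N≤n x₀ p a = subst (λ m → zeros x₀ r m p a ≤ 2 * K ^ m) (sym n≡) (begin
    zeros x₀ r (q * B + s) p a                   ≤⟨ zeros-≤-mixed x₀ r D K^B≡ q s p a ⟩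
    K ^ (q * B + s) + r * D ^ q * K ^ s          ≤⟨ +-monoʳ-≤ (K ^ (q * B + s)) (*-monoˡ-≤ (K ^ s) small) ⟩
    K ^ (q * B + s) + K ^ (q * B) * K ^ s        ≡⟨ cong (K ^ (q * B + s) +_) (^-distribˡ-+-* K (q * B) s) ⟨
    K ^ (q * B + s) + K ^ (q * B + s)            ≡⟨ cong (K ^ (q * B + s) +_) (+-identityʳ _) ⟨
    2 * K ^ (q * B + s)                          ∎)
    where
    open ≤-Reasoning
    q = n / B
    s = n % B
    n≡ : n ≡ q * B + s
    n≡ = trans (m≡m%n+[m/n]*n n B) (+-comm s (q * B))
    q-large : r * D < q
    q-large = ≤-trans (≤-reflexive (sym (m*n/n≡m (suc (r * D)) B))) (/-monoˡ-≤ B N≤n)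
    small : r * D ^ q ≤ K ^ (q * B)
    small = begin
      r * D ^ q         ≤⟨ r*d^q≤[1+d]^q r D q q-large ⟩
      suc D ^ q         ≤⟨ ^-monoˡ-≤ q (≤-trans (+-monoˡ-≤ D 0<r) (≤-reflexive (sym K^B≡))) ⟩
      (K ^ B) ^ q       ≡⟨ ^-*-assoc K B q ⟩
      K ^ (B * q)       ≡⟨ cong (K ^_) (*-comm B q) ⟩
      K ^ (q * B)       ∎

-- From path counts to the size of Z

length-filter-map : {A B : Set} {P : B → Set} (P? : Decidable P) (f : A → B) → ∀ xs →
                    length (filter P? (map f xs)) ≡ length (filter (P? ∘ f) xs)
length-filter-map P? f [] = refl
length-filter-map P? f (x ∷ xs) with P? (f x)
... | yes _ = cong suc (length-filter-map P? f xs)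
... | no _  = length-filter-map P? f xs

length-filter-strings : ∀ {P : Str k (suc n) → Set} (P? : Decidable P) →
  length (filter P? (strings k (suc n))) ≡ ∑ (λ x → length (filter (λ w → P? (x ∷ w)) (strings k n)))
length-filter-strings {k} {n} P? = go id
  where
  go : ∀ {m} (h : Fin m → Fin k) →
       length (filter P? (cartesianProductWith _∷_ (List.tabulate h) (strings k n))) ≡
       ∑ (λ i → length (filter (λ w → P? (h i ∷ w)) (strings k n)))
  go {zero}  h = refl
  go {suc m} h = trans (cong length (List.filter-++ P? (map (h zero ∷_) (strings k n)) _))
    (trans (List.length-++ (filter P? (map (h zero ∷_) (strings k n))))
      (cong₂ _+_ (length-filter-map P? (h zero ∷_) (strings k n)) (go (h ∘ suc))))

length-cartesianProductWith : {A B C : Set} (f : A → B → C) → ∀ xs ys → length (cartesianProductWith f xs ys) ≡ length xs * length ys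
length-cartesianProductWith f []       ys = refl
length-cartesianProductWith f (x ∷ xs) ys = trans (List.length-++ (map (f x) ys))
  (cong₂ _+_ (List.length-map (f x) ys) (length-cartesianProductWith f xs ys))

length-strings : ∀ k n → length (strings k n) ≡ k ^ n
length-strings k zero    = refl
length-strings k (suc n) = trans (length-cartesianProductWith _∷_ (allFin k) (strings k n))
  (cong₂ _*_ (List.length-tabulate {n = k} id) (length-strings k n))

vanishing? : ∀ (x₀ p : Fin (3 + k)) a → Decidable (λ (w : Str (3 + k) n) → a +ℤ path p (toList w ++ [ x₀ ]) ≡ 0ℤ)
vanishing? x₀ p a w = a +ℤ path p (toList w ++ [ x₀ ]) ℤ.≟ 0ℤ

length-filter-≐ : {A : Set} {P Q : A → Set} (P? : Decidable P) (Q? : Decidable Q) →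
                  (∀ {x} → P x → Q x) → (∀ {x} → Q x → P x) → ∀ xs → length (filter P? xs) ≡ length (filter Q? xs)
length-filter-≐ P? Q? P⇒Q Q⇒P xs = cong length (List.filter-≐ P? Q? (P⇒Q , Q⇒P) xs)

zeros-count : ∀ (x₀ : Fin (3 + k)) R n p a →
              R * length (filter (vanishing? x₀ p a) (strings (3 + k) n)) ≡ zeros x₀ R n p a
zeros-count x₀ R zero p a = trans (count-[] (vanishing? x₀ p a))
  (cong (λ b → indicator R (a +ℤ b)) (ℤ.+-identityʳ (cross p x₀)))
  where
  count-[] : {P : Str k 0 → Set} (P? : Decidable P) → R * length (filter P? ([] ∷ [])) ≡ (if does (P? []) then R else 0)
  count-[] P? with P? []
  ... | yes _ = *-identityʳ R
  ... | no _  = *-zeroʳ R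
zeros-count {k} x₀ R (suc n) p a = begin
  R * length (filter (vanishing? x₀ p a) (strings (3 + k) (suc n)))
    ≡⟨ cong (R *_) (length-filter-strings {n = n} (vanishing? x₀ p a)) ⟩
  R * ∑ (λ y → length (filter (λ w → vanishing? x₀ p a (y ∷ w)) (strings (3 + k) n)))
    ≡⟨ *-distribˡ-sum +-*-semiring R (λ y → length (filter (λ w → vanishing? x₀ p a (y ∷ w)) (strings (3 + k) n))) ⟩
  ∑ (λ y → R * length (filter (λ w → vanishing? x₀ p a (y ∷ w)) (strings (3 + k) n)))
    ≡⟨ sum-cong-≗ +-*-semiring (λ y → trans (cong (R *_) (length-filter-≐ (λ w → vanishing? x₀ p a (y ∷ w)) (vanishing? x₀ y (a +ℤ cross p y))
         (λ {w} → trans (ℤ.+-assoc a (cross p y) _)) (λ {w} → trans (sym (ℤ.+-assoc a (cross p y) _))) (strings (3 + k) n)))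
         (zeros-count x₀ R n y (a +ℤ cross p y))) ⟩
  zeros x₀ R (suc n) p a  ∎
  where open ≡-Reasoning

Z-anticoncentrated : ∀ k r → 0 < r → ∃[ N ] ∀ n → N ≤ n → r * Z k (suc n) ≤ 2 * (3 + k) ^ suc n
Z-anticoncentrated k r 0<r = map₂ (λ h n N≤n → begin
  r * Z k (suc n)                                                     ≡⟨ cong (r *_) (length-filter-strings (balanced? {k} {suc n})) ⟩
  r * ∑ (λ x → length (filter (λ w → balanced? (x ∷ w)) (strings (3 + k) n)))
    ≡⟨ *-distribˡ-sum +-*-semiring r (λ x → length (filter (λ w → balanced? (x ∷ w)) (strings (3 + k) n))) ⟩
  ∑ (λ x → r * length (filter (λ w → balanced? (x ∷ w)) (strings (3 + k) n)))
    -- The first symbol `x` plays both ends of the path: it is the initial state and the symbol that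
    -- closes the cycle.
    ≤⟨ ∑-bound _ (λ x → ≤-trans (≤-reflexive (trans (cong (r *_) (length-filter-≐ (λ w → balanced? (x ∷ w)) (vanishing? x x 0ℤ)
         (λ {w} → trans (ℤ.+-identityˡ (winding (x ∷ w)))) (λ {w} → trans (sym (ℤ.+-identityˡ (winding (x ∷ w))))) (strings (3 + k) n))) (zeros-count x r n x 0ℤ))) (h n N≤n x x 0ℤ)) ⟩
  (3 + k) * (2 * (3 + k) ^ n)                                         ≡⟨ solve 2 (λ a b → a :* (con 2 :* b) := con 2 :* (a :* b)) refl (3 + k) ((3 + k) ^ n) ⟩
  2 * (3 + k) ^ suc n                                                 ∎) (zeros-anticoncentrated k r 0<r)
  where
  open ≤-Reasoning
  open +-*-Solver

-- The limit

open import Data.Integer.Base using (+_; _-_)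

-- A positive ε has numerator at least 1, so a comparison with the reciprocal of its denominator
-- suffices.
∣/∣<ε : ∀ i b .{{_ : NonZero b}} (ε : ℚ) → 0ℚ ℚ.< ε → ℤ.∣ i ∣ * ℚ.↧ₙ ε < b → ℚ.∣ i ℚ./ b ℚ.- 0ℚ ∣ ℚ.< ε
∣/∣<ε i (suc b) ε@(mkℚ (+ suc m) d _) _ small = subst (λ q → ℚ.∣ q ∣ ℚ.< ε) (sym (ℚ.+-identityʳ (i ℚ./ suc b)))
  (ℚ.toℚᵘ-cancel-< (ℚᵘ.<-respˡ-≃ (ℚᵘ.≃-sym (ℚᵘ.≃-trans (ℚ.toℚᵘ-homo-∣-∣ (i ℚ./ suc b)) (ℚᵘ.∣-∣-cong (ℚ.toℚᵘ-fromℚᵘ (mkℚᵘ i b)))))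
    (*<* (subst₂ ℤ._<_ (ℤ.pos-* ℤ.∣ i ∣ (suc d)) (ℤ.pos-* (suc m) (suc b)) (ℤ.+<+ (≤-trans small (m≤n*m (suc b) (suc m))))))))
∣/∣<ε i b (mkℚ (+ zero) _ _) (ℚ.*<* (ℤ.+<+ ()))
∣/∣<ε i b (mkℚ ℤ.-[1+ _ ] _ _) (ℚ.*<* ())

2*[n∸m]≤ : ∀ {m n Z} → m ≤ n → n + n ≤ m + m + Z → 2 * (n ∸ m) ≤ Z
2*[n∸m]≤ {m} {n} {Z} m≤n 2n≤ = +-cancelˡ-≤ (m + m) _ _ (begin
  m + m + 2 * (n ∸ m)              ≡⟨ solve 2 (λ m x → m :+ m :+ con 2 :* x := (m :+ x) :+ (m :+ x)) refl m (n ∸ m) ⟩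
  m + (n ∸ m) + (m + (n ∸ m))      ≡⟨ cong₂ _+_ (m+[n∸m]≡n m≤n) (m+[n∸m]≡n m≤n) ⟩
  n + n                            ≤⟨ 2n≤ ⟩
  m + m + Z                        ∎)
  where
  open ≤-Reasoning
  open +-*-Solver

-- Both numbers lie between `(P - Z)/2` and `P/2`.
2*∣m-n∣≤ : ∀ {P Z} m n → m + m ≤ P → n + n ≤ P → P ≤ m + m + Z → P ≤ n + n + Z → 2 * ℤ.∣ + m - + n ∣ ≤ Z
2*∣m-n∣≤ m n 2m≤P 2n≤P P≤2m+Z P≤2n+Z rewrite ℤ.m-n≡m⊖n m n with ≤-total m n
... | inj₁ m≤n rewrite ℤ.∣⊖∣-≤ m≤n = 2*[n∸m]≤ m≤n (≤-trans 2n≤P P≤2m+Z)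
... | inj₂ n≤m rewrite ℤ.∣m⊖n∣≡∣n⊖m∣ m n | ℤ.∣⊖∣-≤ n≤m = 2*[n∸m]≤ n≤m (≤-trans 2m≤P P≤2n+Z)

module _ {P z l} d (0<P : 0 < P) (P≤2l+z : P ≤ l + l + z) (z-small : 4 * suc d * z ≤ 2 * P) where

  private
    z-small′ : (2 + 4 * d) * z ≤ 4 * l
    z-small′ = +-cancelʳ-≤ (2 * z) _ _ (begin
      (2 + 4 * d) * z + 2 * z    ≡⟨ solve 2 (λ d z → (con 2 :+ con 4 :* d) :* z :+ con 2 :* z := con 4 :* (con 1 :+ d) :* z) refl d z ⟩
      4 * suc d * z              ≤⟨ z-small ⟩
      2 * P                      ≤⟨ *-monoʳ-≤ 2 P≤2l+z ⟩
      2 * (l + l + z)            ≡⟨ solve 2 (λ l z → con 2 :* (l :+ l :+ z) := con 4 :* l :+ con 2 :* z) refl l z ⟩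
      4 * l + 2 * z              ∎)
      where
      open ≤-Reasoning
      open +-*-Solver

  l-positive : 0 < l
  l-positive = n≢0⇒n>0 λ l≡0 → <⇒≱ 0<P (begin
    P                            ≤⟨ P≤2l+z ⟩
    l + l + z                    ≡⟨ cong (λ x → x + x + z) l≡0 ⟩
    z                            ≤⟨ m≤n*m z (2 + 4 * d) ⟩
    (2 + 4 * d) * z              ≤⟨ z-small′ ⟩
    4 * l                        ≡⟨ cong (4 *_) l≡0 ⟩
    0                            ∎)
    where open ≤-Reasoning

  x*d<l : ∀ x → 2 * x ≤ z → x * d < l
  x*d<l x 2x≤z = below x (*-cancelˡ-≤ 4 (begin
    4 * ((1 + 2 * d) * x)        ≡⟨ solve 2 (λ d x → con 4 :* ((con 1 :+ con 2 :* d) :* x) := (con 2 :+ con 4 :* d) :* (con 2 :* x)) refl d x ⟩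
    (2 + 4 * d) * (2 * x)        ≤⟨ *-monoʳ-≤ (2 + 4 * d) 2x≤z ⟩
    (2 + 4 * d) * z              ≤⟨ z-small′ ⟩
    4 * l                        ∎))
    where
    open ≤-Reasoning
    open +-*-Solver
    -- For positive `x` the surplus `(1 + d) * x` gives strictness; for `x = 0` it comes from
    -- `l-positive`.
    below : ∀ x → (1 + 2 * d) * x ≤ l → x * d < l
    below zero    _   = l-positive
    below (suc x) x≤l = begin-strict
      suc x * d                    <⟨ s≤s (m≤n+m (suc x * d) x) ⟩
      suc x + suc x * d            ≤⟨ m≤m+n _ (suc x * d) ⟩
      suc x + suc x * d + suc x * d
        ≡⟨ solve 2 (λ d x → x :+ x :* d :+ x :* d := (con 1 :+ con 2 :* d) :* x) refl d (suc x) ⟩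
      (1 + 2 * d) * suc x          ≤⟨ x≤l ⟩
      l                            ∎

quotient-bound : ∀ k n (ε : ℚ) → 0ℚ ℚ.< ε → 4 * suc (ℚ.↧ₙ ε) * Z k (3 + n) ≤ 2 * (3 + k) ^ (3 + n) →
                 Σ[ nz ∈ NonZero (L (3 + k) (3 + n)) ]
                   ℚ.∣ ℚ._/_ (+ M (3 + k) (3 + n) - + L (3 + k) (3 + n)) (L (3 + k) (3 + n)) {{nz}} ℚ.- 0ℚ ∣ ℚ.< ε
quotient-bound k n ε 0<ε Z-small =
  nz , ∣/∣<ε (+ m - + l) l {{nz}} ε 0<ε (x*d<l {P} {z} {l} d P>0 P≤2L+Z Z-small ℤ.∣ + m - + l ∣
         (2*∣m-n∣≤ {P} {z} m l (≤P (2M≤|strings| (3 + k) (3 + n))) (≤P (2L≤|strings| (3 + k) (3 + n)))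
            (P≤ (|strings|≤2M+Z k n)) P≤2L+Z))
  where
  d = ℚ.↧ₙ ε
  m = M (3 + k) (3 + n)
  l = L (3 + k) (3 + n)
  z = Z k (3 + n)
  P = (3 + k) ^ (3 + n)

  P>0 : 0 < P
  P>0 = m^n>0 (3 + k) (3 + n)

  ≤P : ∀ {x} → x ≤ length (strings (3 + k) (3 + n)) → x ≤ P
  ≤P {x} = subst (x ≤_) (length-strings (3 + k) (3 + n))

  P≤ : ∀ {x} → length (strings (3 + k) (3 + n)) ≤ x → P ≤ x
  P≤ {x} = subst (_≤ x) (length-strings (3 + k) (3 + n))

  P≤2L+Z : P ≤ l + l + z
  P≤2L+Z = P≤ (|strings|≤2L+Z k (3 + n))

  nz : NonZero l
  nz = >-nonZero (l-positive {P} {z} {l} d P>0 P≤2L+Z Z-small)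

mainTheorem12 : (k : ℕ) → 3 ≤ k → QuotientTendsTo (λ n → (+ M k n) - (+ L k n)) (λ n → L k n) 0ℚ
mainTheorem12 (suc (suc (suc k))) (s≤s (s≤s (s≤s z≤n))) ε 0<ε =
  -- With `d` the denominator of ε, weight `4 * (1 + d)` and `P ≤ 2l + z` leave `(2 + 4d) * z ≤ 4l`;
  -- this forces `l > 0` and, since `2 * |M - L| ≤ z`, also `|M - L| * d < l`.
  eventually (Z-anticoncentrated k (4 * suc (ℚ.↧ₙ ε)) z<s)
  where
  Close : ℕ → Set
  Close n = Σ[ nz ∈ NonZero (L (3 + k) n) ]
              ℚ.∣ ℚ._/_ (+ M (3 + k) n - + L (3 + k) n) (L (3 + k) n) {{nz}} ℚ.- 0ℚ ∣ ℚ.< ε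

  eventually : ∃[ N ] (∀ n → N ≤ n → 4 * suc (ℚ.↧ₙ ε) * Z k (suc n) ≤ 2 * (3 + k) ^ suc n) →
               ∃[ N ] (∀ n → N ≤ n → Close n)
  eventually (N , Z-small) = 3 + N , close
    where
    close : ∀ n → 3 + N ≤ n → Close n
    close (suc (suc (suc n))) (s≤s (s≤s (s≤s N≤n))) =
      quotient-bound k n ε 0<ε (Z-small (2 + n) (m≤n⇒m≤1+n (m≤n⇒m≤1+n N≤n)))
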